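{- Let $T$ be a rational pinwheel tiling. The minimal number of colours in a proper face colouring of $T$ is $3$.
   Context: Rational pinwheel substitution. The prototile $K$ is the right triangle with side lengths $1,2,\sqrt5$. The substitution $\omega$ expands a tile by $\sqrt5$ and dissects it into five tiles: the expanded tile, placed as the triangle with vertices $(0,0)$ (right angle), $(2,-1)$, $(2,4)$, is dissected into the triangles with vertices $\{(2,-1),(2,0),(0,0)\}$, $\{(0,0),(1,0),(1,2)\}$, $\{(1,0),(2,0),(2,2)\}$, $\{(1,0),(1,2),(2,2)\}$, $\{(1,2),(2,2),(2,4)\}$. The rule is extended to all congruent copies of $K$ (including reflections) and to collections of tiles covariantly. A rational pinwheel tiling is a tiling $T$ of $\mathbb{R}^2$ by congruent copies of $K$ such that every finite set of tiles of $T$ is contained in a congruent copy of $\omega^n(K)$ for some $n\ge0$. A proper face colouring is an assignment of colours to the tiles such that any two distinct tiles whose boundaries share a segment of positive length have different colours. -}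

module Defs where

open import Algebra.Bundles using (CommutativeRing)
import Algebra.Definitions.RawMonoid as RawMonoidDefinitions
open import Data.Fin.Base using (Fin)
open import Data.Integer.Base as ℤ using (ℤ; +_; -[1+_]; -1ℤ)
open import Data.List.Base using (List; []; _∷_; [_]; map; concatMap)
import Data.List.Relation.Binary.Subset.Setoid as Subset
open import Data.List.Relation.Unary.All using (All)
open import Data.Nat.Base as ℕ using (ℕ; zero)
open import Data.Product.Base using (∃-syntax; _×_; _,_)
open import Data.Product.Relation.Binary.Pointwise.NonDependent using (_×ₛ_)
open import Data.Sum.Base using (_⊎_)
open import Level using (0ℓ)
open import Relation.Binary.Bundles using (Setoid)
open import Relation.Binary.Construct.StrictToNonStrict as NonStrict using ()
open import Relation.Binary.Core using (Rel)
open import Relation.Binary.Definitions using (_Respects_)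
open import Relation.Binary.PropositionalEquality.Core using (_≡_; _≢_)
open import Relation.Binary.Structures using (IsStrictTotalOrder)
open import Relation.Nullary.Negation.Core using (¬_)
open import Relation.Unary using (Pred; Satisfiable)

-- The classical axioms of a complete ordered field, which determine ℝ up to
-- unique isomorphism.  As usual for a total inverse function, x ⁻¹ is
-- unconstrained at x ≈ 0#.

record RealNumbers : Set₁ where
  infix  4 _<_
  infix  8 _⁻¹
  field
    commutativeRing : CommutativeRing 0ℓ 0ℓ

  open CommutativeRing commutativeRing public

  field
    _<_                : Rel Carrier 0ℓ
    isStrictTotalOrder : IsStrictTotalOrder _≈_ _<_
    0<1                : 0# < 1#
    +-monoˡ-<          : ∀ z {x y} → x < y → x + z < y + z
    *-pos              : ∀ {x y} → 0# < x → 0# < y → 0# < x * y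
    _⁻¹                : Carrier → Carrier
    ⁻¹-inverseʳ        : ∀ x → ¬ x ≈ 0# → x * x ⁻¹ ≈ 1#

  open NonStrict _≈_ _<_ public using (_≤_)

  UpperBound : Pred Carrier 0ℓ → Pred Carrier 0ℓ
  UpperBound P b = ∀ {x} → P x → x ≤ b

  field
    complete : ∀ (P : Pred Carrier 0ℓ) → Satisfiable P → Satisfiable (UpperBound P) →
               ∃[ s ] (UpperBound P s × (∀ {b} → UpperBound P b → s ≤ b))

module Pinwheel (ℝ : RealNumbers) where
  open RealNumbers ℝ
  open RawMonoidDefinitions +-rawMonoid using () renaming (_×_ to _·_)

  fromℤ : ℤ → Carrier
  fromℤ (+ n)    = n · 1#
  fromℤ -[1+ n ] = - (ℕ.suc n · 1#)

  infixl 7 _/_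
  _/_ : ℤ → ℤ → Carrier
  m / n = fromℤ m * fromℤ n ⁻¹

  pointSetoid : Setoid 0ℓ 0ℓ
  pointSetoid = setoid ×ₛ setoid

  open Setoid pointSetoid using () renaming (Carrier to Point; _≈_ to _≈ₚ_) public

  infixl 6 _⊕_ _⊖_
  infixr 7 _∙_

  _⊕_ _⊖_ : Point → Point → Point
  (x , y) ⊕ (x′ , y′) = x + x′ , y + y′
  (x , y) ⊖ (x′ , y′) = x - x′ , y - y′

  _∙_ : Carrier → Point → Point
  c ∙ (x , y) = c * x , c * y

  dist² : Point → Point → Carrier
  dist² (x , y) (x′ , y′) = (x - x′) * (x - x′) + (y - y′) * (y - y′)

  IsIsometry : (Point → Point) → Set
  IsIsometry f = ∀ p q → dist² (f p) (f q) ≈ dist² p q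

  -- A triangle is listed as (right-angle vertex, other end of the short leg,
  -- other end of the long leg).  The sides of K have distinct lengths, so a
  -- congruent copy of K has exactly one such listing, and equality of tiles as
  -- subsets of the plane is vertexwise equality.

  triangleSetoid : Setoid 0ℓ 0ℓ
  triangleSetoid = pointSetoid ×ₛ (pointSetoid ×ₛ pointSetoid)

  open Setoid triangleSetoid using () renaming (Carrier to Triangle; _≈_ to _≈△_) public
  open Subset triangleSetoid using (_⊆_)

  image : (Point → Point) → Triangle → Triangle
  image f (a , b , c) = f a , f b , f c

  K : Triangle
  K = (0# , 0#) , (1# , 0#) , (0# , fromℤ (+ 2))

  CongruentToK : Pred Triangle 0ℓ
  CongruentToK t = ∃[ f ] (IsIsometry f × t ≈△ image f K)

  infix 4 _∈△_ _∈int_ _∈[_,_] _∈∂_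

  _∈△_ _∈int_ : Point → Triangle → Set
  p ∈△ (a , b , c) =
    ∃[ α ] ∃[ β ] ∃[ γ ] (0# ≤ α × 0# ≤ β × 0# ≤ γ × α + β + γ ≈ 1# ×
                          p ≈ₚ α ∙ a ⊕ β ∙ b ⊕ γ ∙ c)
  p ∈int (a , b , c) =
    ∃[ α ] ∃[ β ] ∃[ γ ] (0# < α × 0# < β × 0# < γ × α + β + γ ≈ 1# ×
                          p ≈ₚ α ∙ a ⊕ β ∙ b ⊕ γ ∙ c)

  _∈[_,_] : Point → Point → Point → Set
  x ∈[ p , q ] = ∃[ l ] (0# ≤ l × l ≤ 1# × x ≈ₚ (1# - l) ∙ p ⊕ l ∙ q)

  _∈∂_ : Point → Triangle → Set
  x ∈∂ (a , b , c) = x ∈[ a , b ] ⊎ x ∈[ b , c ] ⊎ x ∈[ c , a ]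

  ShareSegment : Rel Triangle 0ℓ
  ShareSegment t u =
    ∃[ p ] ∃[ q ] (¬ p ≈ₚ q × (∀ x → x ∈[ p , q ] → x ∈∂ t × x ∈∂ u))

  -- place (A , B , C) x y is the image of (x , y) under the affine map sending
  -- (0,0), (2,-1), (2,4) to A, B, C: its coordinates (r , s) in the frame
  -- A; B ⊖ A, C ⊖ A solve (x , y) = r (2 , -1) + s (2 , 4).  For A, B, C an
  -- expanded tile this map is an isometry, so placing is covariant.

  place : Triangle → ℤ → ℤ → Point
  place (A , B , C) x y =
    A ⊕ (((+ 2 ℤ.* x ℤ.- y) / + 5)  ∙ (B ⊖ A))
      ⊕ (((x ℤ.+ + 2 ℤ.* y) / + 10) ∙ (C ⊖ A))

  dissect : Triangle → List Triangle
  dissect t = (at (+ 2) (+ 0) , at (+ 2) -1ℤ   , at (+ 0) (+ 0))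
            ∷ (at (+ 1) (+ 0) , at (+ 0) (+ 0) , at (+ 1) (+ 2))
            ∷ (at (+ 2) (+ 0) , at (+ 1) (+ 0) , at (+ 2) (+ 2))
            ∷ (at (+ 1) (+ 2) , at (+ 2) (+ 2) , at (+ 1) (+ 0))
            ∷ (at (+ 2) (+ 2) , at (+ 1) (+ 2) , at (+ 2) (+ 4))
            ∷ []
    where at = place t

  IsSqrt5 : Pred Carrier 0ℓ
  IsSqrt5 s = 0# < s × s * s ≈ fromℤ (+ 5)

  module Substitution (√5 : Carrier) where

    ω : List Triangle → List Triangle
    ω = concatMap (λ t → dissect (image (√5 ∙_) t))

    ω^_[K] : ℕ → List Triangle
    ω^ zero [K]      = [ K ]
    ω^ (ℕ.suc n) [K] = ω (ω^ n [K])

    record IsRationalPinwheelTiling (T : Pred Triangle 0ℓ) : Set where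
      field
        respects-≈ : T Respects _≈△_
        tiles      : ∀ {t} → T t → CongruentToK t
        covers     : ∀ p → ∃[ t ] (T t × p ∈△ t)
        packs      : ∀ {t u} → T t → T u → ¬ t ≈△ u → ∀ p → ¬ (p ∈int t × p ∈int u)
        patches    : ∀ ts → All T ts →
                     ∃[ n ] ∃[ f ] (IsIsometry f × ts ⊆ map (image f) ω^ n [K])

  record ProperFaceColouring (T : Pred Triangle 0ℓ) (k : ℕ) : Set where
    field
      colour      : ∀ t → T t → Fin k
      colour-cong : ∀ {t u} (t∈T : T t) (u∈T : T u) → t ≈△ u → colour t t∈T ≡ colour u u∈T
      proper      : ∀ {t u} (t∈T : T t) (u∈T : T u) → ¬ t ≈△ u → ShareSegment t u →
                    colour t t∈T ≢ colour u u∈T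

  MinimalNumberOfColours : Pred Triangle 0ℓ → ℕ → Set
  MinimalNumberOfColours T k =
    ProperFaceColouring T k × (∀ m → ProperFaceColouring T m → k ℕ.≤ m)

{-# OPTIONS --safe #-}
-- Identify a tile with the map z ↦ a + e z of ℤ[i], where a is its right angle
-- and the unit e its short leg.  Then all tiles of ω^n(K) lie on one lattice, and
-- two of them that have two points in common differ by one of nine maps: their
-- supertiles coincide or have two points in common as well, so by induction
-- finitely many pairs remain, and separating lines settle these.
--
-- The residue of a / e modulo 10 determines a colour of the tile (a , e) such
-- that contacts get distinct colours.  A tiling does not determine the origin of
-- the lattice of ω^n(K), but it only matters modulo 10, and for finitely many
-- tiles some residue is right.  Completeness of ℝ implies weak excluded middle,
-- which suffices to find a residue that is right for the whole tiling.
--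
-- Conversely ω²(K) has three pairwise adjacent tiles.  They occur in T: relative
-- to a given tile there are finitely many candidates for them, and a patch that
-- contains the given tile and the tiles of T over the centroids of all
-- candidates contains the right candidates, since interiors are disjoint.

module Submission where

open import Defs
open import Level using (0ℓ)
open import Relation.Unary using (Pred)
open import Algebra.Solver.Ring.AlmostCommutativeRing using (fromCommutativeRing; _-Raw-AlmostCommutative⟶_)
open import Data.Empty using (⊥)
open import Data.Fin.Base using (Fin; toℕ; fromℕ<)
open import Data.Fin.Patterns using (0F; 1F; 2F; 3F; 4F)
import Data.Fin.Properties as Fin
open import Data.Integer.Base as ℤ using (ℤ; +_; -[1+_]; 0ℤ; 1ℤ; -1ℤ)
import Data.Integer.DivMod as ℤ
import Data.Integer.Properties as ℤ
open import Data.Integer.Tactic.RingSolver using (solve-∀)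
open import Data.List.Base using (List; []; _∷_; map; cartesianProduct; allFin)
open import Data.List.Membership.Propositional using (_∈_; find)
open import Data.List.Membership.Propositional.Properties using (∈-allFin; ∈-cartesianProduct⁺; ∈-map⁺)
open import Data.List.Relation.Unary.All as All using (All; []; _∷_; all?)
import Data.List.Relation.Unary.All.Properties as All
open import Data.List.Relation.Unary.Any as Any using (Any; here; there; any?)
import Data.List.Relation.Unary.Any.Properties as Any
import Data.Maybe.Base as Maybe
open import Data.Nat.Base as ℕ using (ℕ; zero; suc)
import Data.Nat.Divisibility as ℕ
import Data.Nat.DivMod as ℕ
import Data.Nat.Properties as ℕ
open import Data.Product.Base using (Σ-syntax; ∃-syntax; _×_; _,_; proj₁; proj₂)
import Data.Product.Properties as Product
open import Data.Sum.Base using (_⊎_; inj₁; inj₂)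
open import Data.Unit.Base using (tt)
open import Data.Vec.Base using (Vec; []; _∷_; _++_)
import Data.Vec.Properties as Vec
open import Function.Base using (_∘_)
open import Relation.Binary.Bundles using (Setoid)
open import Relation.Binary.Definitions using (DecidableEquality; tri<; tri≈; tri>)
open import Relation.Binary.PropositionalEquality.Core as ≡ using (_≡_; _≢_)
open import Relation.Binary.Structures using (IsStrictTotalOrder)
open import Relation.Nullary.Decidable using (Dec; yes; no; _×-dec_; _⊎-dec_; _→-dec_; ¬?; toWitness; dec⇒maybe)
open import Relation.Nullary.Negation.Core using (¬_; contradiction)

-- All five tiles of `dissect` have legs parallel to the axes and the handedness opposite to that of
-- the expanded tile. So all tiles of ω^n(K) have the same handedness and differ in direction by
-- multiples of a right angle; this is why one lattice and a unit `e` describe them. A substitution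
-- step acts on the lattice as z ↦ (2 + i) conj z, and twice this map is multiplication by 5. The
-- colour uses a / e only modulo 2 (2 + i): the class modulo 2 + i comes from the position in the
-- supertile, the parities from the place in the lattice. The least positive integer divisible by 2
-- (2 + i) is 10, so residues can be taken coordinatewise. The obstacle is the passage to T: patches
-- have different levels and their lattices have unrelated origins. All patches agree, however, on
-- the placement of a tile relative to a fixed tile of T, so the colour is computed from this
-- placement and one unknown residue. The residue must be found, as colours are data, but properness
-- of the colouring is a negative statement; its double negation is enough, and that can be decided.

module Placements where
  open import Data.Integer.Base using (_+_; _*_; _-_; -_; _⊔_)
  open ≡ using (refl; sym; trans; cong; cong₂; subst)

  -- Gaussian placements

  Gauss : Set
  Gauss = ℤ × ℤ

  infixl 6 _⊞_
  infixl 7 _⊠_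

  _⊞_ _⊠_ : Gauss → Gauss → Gauss
  (x , y) ⊞ (x′ , y′) = x + x′ , y + y′
  (x , y) ⊠ (x′ , y′) = x * x′ - y * y′ , x * y′ + y * x′

  conj : Gauss → Gauss
  conj (x , y) = x , - y

  neg : Gauss → Gauss
  neg (x , y) = - x , - y

  norm : Gauss → ℤ
  norm (x , y) = x * x + y * y

  -- (a , e) stands for the tile with right angle at a, short leg e and long leg
  -- 2ie; equivalently, for the map z ↦ a + e z.
  Placement : Set
  Placement = Gauss × Gauss

  infixl 7 _⋄_

  _⋄_ : Placement → Placement → Placement
  (a , e) ⋄ (b , d) = a ⊞ e ⊠ b , e ⊠ d

  one : Placement
  one = (0ℤ , 0ℤ) , (1ℤ , 0ℤ)

  inv : Placement → Placement
  inv (a , e) = neg (conj e ⊠ a) , conj e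

  -- Multiplication by 2 + i after a reflection expands by √5 and undoes the
  -- reversal of orientation caused by the substitution.
  φ : Gauss → Gauss
  φ (x , y) = + 2 * x + y , x - + 2 * y

  κ : Placement → Placement
  κ (a , e) = φ a , conj e

  Unit : Placement → Set
  Unit (_ , e) = norm e ≡ 1ℤ

  -- The tiles of dissect, in order, reflected in the first axis.
  child : Fin 5 → Placement
  child 0F = (+ 2 , 0ℤ)     , (0ℤ , 1ℤ)
  child 1F = (1ℤ , 0ℤ)      , (-1ℤ , 0ℤ)
  child 2F = (+ 2 , 0ℤ)     , (-1ℤ , 0ℤ)
  child 3F = (1ℤ , -[1+ 1 ]) , (1ℤ , 0ℤ)
  child 4F = (+ 2 , -[1+ 1 ]) , (-1ℤ , 0ℤ)

  -- The first letter of an address is the position in the smallest supertile.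
  Address : ℕ → Set
  Address = Vec (Fin 5)

  -- The tail places the smallest supertile in the coarser lattice of the supertiles; `κ` rewrites
  -- this placement in the lattice of the tiles.
  pos : ∀ {n} → Address n → Placement
  pos []      = one
  pos (i ∷ w) = κ (pos w) ⋄ child i

  ⋄-assoc : ∀ g h k → (g ⋄ h) ⋄ k ≡ g ⋄ (h ⋄ k)
  ⋄-assoc ((a , b) , (p , q)) ((c , d) , (r , s)) ((e , f) , (t , u)) =
    cong₂ _,_ (cong₂ _,_ (re a b c d p q r s e f) (im a b c d p q r s e f)) (cong₂ _,_ (re′ p q r s t u) (im′ p q r s t u))
    where
    re : ∀ a b c d p q r s e f → a + (p * c - q * d) + ((p * r - q * s) * e - (p * s + q * r) * f)
       ≡ a + (p * (c + (r * e - s * f)) - q * (d + (r * f + s * e)))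
    re = solve-∀
    im : ∀ a b c d p q r s e f → b + (p * d + q * c) + ((p * r - q * s) * f + (p * s + q * r) * e)
       ≡ b + (p * (d + (r * f + s * e)) + q * (c + (r * e - s * f)))
    im = solve-∀
    re′ : ∀ p q r s t u → (p * r - q * s) * t - (p * s + q * r) * u ≡ p * (r * t - s * u) - q * (r * u + s * t)
    re′ = solve-∀
    im′ : ∀ p q r s t u → (p * r - q * s) * u + (p * s + q * r) * t ≡ p * (r * u + s * t) + q * (r * t - s * u)
    im′ = solve-∀

  -- `φ z` is (2 + i) conj z, so it is additive and takes `e ⊠ b` to `conj e ⊠ φ b`.
  κ-⋄ : ∀ g h → κ (g ⋄ h) ≡ κ g ⋄ κ h
  κ-⋄ ((a , b) , (p , q)) ((c , d) , (r , s)) =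
    cong₂ _,_ (cong₂ _,_ (re a b c d p q) (im a b c d p q)) (cong₂ _,_ (re′ p q r s) (im′ p q r s))
    where
    re : ∀ a b c d p q → + 2 * (a + (p * c - q * d)) + (b + (p * d + q * c))
       ≡ + 2 * a + b + (p * (+ 2 * c + d) - (- q) * (c - + 2 * d))
    re = solve-∀
    im : ∀ a b c d p q → a + (p * c - q * d) - + 2 * (b + (p * d + q * c))
       ≡ a - + 2 * b + (p * (c - + 2 * d) + (- q) * (+ 2 * c + d))
    im = solve-∀
    re′ : ∀ p q r s → p * r - q * s ≡ p * r - (- q) * (- s)
    re′ = solve-∀
    im′ : ∀ p q r s → - (p * s + q * r) ≡ p * (- s) + (- q) * r
    im′ = solve-∀

  one-⋄ : ∀ g → one ⋄ g ≡ g
  one-⋄ ((a , b) , (p , q)) = cong₂ _,_ (cong₂ _,_ (re′ a b) (im′ a b)) (cong₂ _,_ (re p q) (im p q))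
    where
    re : ∀ a b → 1ℤ * a - 0ℤ * b ≡ a
    re = solve-∀
    im : ∀ a b → 1ℤ * b + 0ℤ * a ≡ b
    im = solve-∀
    re′ : ∀ a b → 0ℤ + (1ℤ * a - 0ℤ * b) ≡ a
    re′ = solve-∀
    im′ : ∀ a b → 0ℤ + (1ℤ * b + 0ℤ * a) ≡ b
    im′ = solve-∀

  ⋄-one : ∀ g → g ⋄ one ≡ g
  ⋄-one ((a , b) , (p , q)) = cong₂ _,_ (cong₂ _,_ (re′ a p q) (im′ b p q)) (cong₂ _,_ (re p q) (im p q))
    where
    re : ∀ p q → p * 1ℤ - q * 0ℤ ≡ p
    re = solve-∀
    im : ∀ p q → p * 0ℤ + q * 1ℤ ≡ q
    im = solve-∀
    re′ : ∀ a p q → a + (p * 0ℤ - q * 0ℤ) ≡ a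
    re′ = solve-∀
    im′ : ∀ b p q → b + (p * 0ℤ + q * 0ℤ) ≡ b
    im′ = solve-∀

  Unit-⋄ : ∀ g h → Unit g → Unit h → Unit (g ⋄ h)
  Unit-⋄ (_ , (p , q)) (_ , (r , s)) u v = trans (multiplicative p q r s) (cong₂ _*_ u v)
    where
    multiplicative : ∀ p q r s → (p * r - q * s) * (p * r - q * s) + (p * s + q * r) * (p * s + q * r) ≡ (p * p + q * q) * (r * r + s * s)
    multiplicative = solve-∀

  Unit-κ : ∀ g → Unit g → Unit (κ g)
  Unit-κ (_ , (p , q)) u = trans (conjugate p q) u
    where
    conjugate : ∀ p q → p * p + (- q) * (- q) ≡ p * p + q * q
    conjugate = solve-∀

  Unit-child : ∀ i → Unit (child i)
  Unit-child 0F = refl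
  Unit-child 1F = refl
  Unit-child 2F = refl
  Unit-child 3F = refl
  Unit-child 4F = refl

  Unit-pos : ∀ {n} (w : Address n) → Unit (pos w)
  Unit-pos []      = refl
  Unit-pos (i ∷ w) = Unit-⋄ (κ (pos w)) (child i) (Unit-κ (pos w) (Unit-pos w)) (Unit-child i)

  inv-inverseʳ : ∀ g → Unit g → g ⋄ inv g ≡ one
  inv-inverseʳ ((a , b) , (p , q)) u =
    cong₂ _,_ (cong₂ _,_ (trans (re a b p q) (vanish a)) (trans (im a b p q) (vanish b)))
              (cong₂ _,_ (trans (re′ p q) u) (im′ p q))
    where
    re : ∀ a b p q → a + (p * (- (p * a - (- q) * b)) - q * (- (p * b + (- q) * a))) ≡ a * (1ℤ - (p * p + q * q))
    re = solve-∀
    im : ∀ a b p q → b + (p * (- (p * b + (- q) * a)) + q * (- (p * a - (- q) * b))) ≡ b * (1ℤ - (p * p + q * q))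
    im = solve-∀
    vanish : ∀ a → a * (1ℤ - (p * p + q * q)) ≡ 0ℤ
    vanish a = trans (cong (λ n → a * (1ℤ - n)) u) (ℤ.*-zeroʳ a)
    re′ : ∀ p q → p * p - q * (- q) ≡ p * p + q * q
    re′ = solve-∀
    im′ : ∀ p q → p * (- q) + q * p ≡ 0ℤ
    im′ = solve-∀

  inv-inverseˡ : ∀ g → Unit g → inv g ⋄ g ≡ one
  inv-inverseˡ ((a , b) , (p , q)) u =
    cong₂ _,_ (cong₂ _,_ (re a b p q) (im a b p q))
              (cong₂ _,_ (trans (re′ p q) u) (im′ p q))
    where
    re : ∀ a b p q → - (p * a - (- q) * b) + (p * a - (- q) * b) ≡ 0ℤ
    re = solve-∀
    im : ∀ a b p q → - (p * b + (- q) * a) + (p * b + (- q) * a) ≡ 0ℤ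
    im = solve-∀
    re′ : ∀ p q → p * p - (- q) * q ≡ p * p + q * q
    re′ = solve-∀
    im′ : ∀ p q → p * q + (- q) * p ≡ 0ℤ
    im′ = solve-∀

  Unit-inv : ∀ g → Unit g → Unit (inv g)
  Unit-inv (_ , (p , q)) u = Unit-κ ((0ℤ , 0ℤ) , (p , q)) u

  ⋄-cancel-inv : ∀ g h → Unit g → g ⋄ (inv g ⋄ h) ≡ h
  ⋄-cancel-inv g h u = trans (sym (⋄-assoc g (inv g) h)) (trans (cong (_⋄ h) (inv-inverseʳ g u)) (one-⋄ h))

  inv-⋄-cancel : ∀ g h → Unit g → inv g ⋄ (g ⋄ h) ≡ h
  inv-⋄-cancel g h u = trans (sym (⋄-assoc (inv g) g h)) (trans (cong (_⋄ h) (inv-inverseˡ g u)) (one-⋄ h))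

  Corners : Set
  Corners = Gauss × Gauss × Gauss

  corners : Placement → Corners
  corners ((a , b) , (p , q)) = (a , b) , (a + p , b + q) , (a - + 2 * q , b + + 2 * p)

  apply : Placement → Gauss → Gauss
  apply (a , e) z = a ⊞ e ⊠ z

  corners-⋄ : ∀ g h → let (a , b , c) = corners h in corners (g ⋄ h) ≡ (apply g a , apply g b , apply g c)
  corners-⋄ ((a , b) , (p , q)) ((c , d) , (r , s)) = cong₂ _,_ refl (cong₂ _,_
    (cong₂ _,_ (re a p q c d r s) (im b p q c d r s)) (cong₂ _,_ (re′ a p q c d r s) (im′ b p q c d r s)))
    where
    re : ∀ a p q c d r s → a + (p * c - q * d) + (p * r - q * s) ≡ a + (p * (c + r) - q * (d + s))
    re = solve-∀
    im : ∀ b p q c d r s → b + (p * d + q * c) + (p * s + q * r) ≡ b + (p * (d + s) + q * (c + r))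
    im = solve-∀
    re′ : ∀ a p q c d r s → a + (p * c - q * d) - + 2 * (p * s + q * r)
        ≡ a + (p * (c - + 2 * s) - q * (d + + 2 * r))
    re′ = solve-∀
    im′ : ∀ b p q c d r s → b + (p * d + q * c) + + 2 * (p * r - q * s)
        ≡ b + (p * (d + + 2 * r) + q * (c - + 2 * s))
    im′ = solve-∀

  -- Contacts

  height : Gauss → Gauss → ℤ
  height (d , d′) (x , y) = d * x + d′ * y

  top : Gauss → Corners → ℤ
  top d (a , b , c) = height d a ⊔ height d b ⊔ height d c

  rotate : Corners → Corners
  rotate (a , b , c) = b , c , a

  Separates : Gauss → Corners → Corners → Set
  Separates d (a , b , c) σ = top d σ ℤ.≤ height d a × top d σ ℤ.≤ height d b × top d σ ℤ.≤ height d c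

  separates? : ∀ d τ σ → Dec (Separates d τ σ)
  separates? d (a , b , c) σ = (_ ℤ.≤? _) ×-dec (_ ℤ.≤? _) ×-dec (_ ℤ.≤? _)

  FirstAbove : Gauss → Corners → Corners → Set
  FirstAbove d (a , _ , _) σ = top d σ ℤ.< height d a

  firstAbove? : ∀ d τ σ → Dec (FirstAbove d τ σ)
  firstAbove? d (a , b , c) σ = _ ℤ.<? _

  -- Normals to the legs and to the two possible directions of a hypotenuse, with both signs because
  -- `Separates` puts its first triangle above the line. The diagonal (1, 1) is normal to no side of
  -- a tile, so a supporting line with this normal touches a tile only in a corner.
  directions : List Gauss
  directions = (1ℤ , 0ℤ) ∷ (-1ℤ , 0ℤ) ∷ (0ℤ , 1ℤ) ∷ (0ℤ , -1ℤ) ∷ (+ 2 , 1ℤ) ∷ (-[1+ 1 ] , -1ℤ) ∷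
               (1ℤ , 1ℤ) ∷ (-1ℤ , -1ℤ) ∷ (1ℤ , -[1+ 1 ]) ∷ (-1ℤ , + 2) ∷ []

  -- Some line separates τ from σ and meets τ at most in its first corner.
  Supported : Corners → Corners → Set
  Supported τ σ = Any (λ d → Separates d τ σ × FirstAbove d (rotate τ) σ × FirstAbove d (rotate (rotate τ)) σ) directions

  supported? : ∀ τ σ → Dec (Supported τ σ)
  supported? τ σ = any? (λ d → separates? d τ σ ×-dec firstAbove? d (rotate τ) σ ×-dec firstAbove? d (rotate (rotate τ)) σ) directions

  Apart : Corners → Corners → Set
  Apart τ σ = Supported τ σ ⊎ Supported (rotate τ) σ ⊎ Supported (rotate (rotate τ)) σ

  apart? : ∀ τ σ → Dec (Apart τ σ)
  apart? τ σ = supported? τ σ ⊎-dec supported? (rotate τ) σ ⊎-dec supported? (rotate (rotate τ)) σ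

  -- Some line separates τ from σ without containing τ.
  Disjoint : Corners → Corners → Set
  Disjoint τ σ = Any (λ d → Separates d τ σ × (FirstAbove d τ σ ⊎ FirstAbove d (rotate τ) σ ⊎ FirstAbove d (rotate (rotate τ)) σ)) directions

  disjoint? : ∀ τ σ → Dec (Disjoint τ σ)
  disjoint? τ σ = any? (λ d → separates? d τ σ ×-dec (firstAbove? d τ σ ⊎-dec firstAbove? d (rotate τ) σ ⊎-dec firstAbove? d (rotate (rotate τ)) σ)) directions

  _≟ᵍ_ : DecidableEquality Gauss
  _≟ᵍ_ = Product.≡-dec ℤ._≟_ ℤ._≟_

  _≟ₚ_ : DecidableEquality Placement
  _≟ₚ_ = Product.≡-dec _≟ᵍ_ _≟ᵍ_

  siblings-disjoint : ∀ i j → i ≢ j → Disjoint (corners (child i)) (corners (child j))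
  siblings-disjoint = toWitness {a? = Fin.all? λ i → Fin.all? λ j → ¬? (i Fin.≟ j) →-dec disjoint? (corners (child i)) (corners (child j))} tt

  -- Rotations by ± 90° about lattice points, and half turns about points of the
  -- long leg (half-hyp: about the midpoint of the hypotenuse).
  quarter₁ quarter₂ quarter₃ quarter₄ half₀ half₁ half₂ half₃ half-hyp : Placement
  quarter₁ = (-1ℤ , 0ℤ) , (0ℤ , -1ℤ)
  quarter₂ = (0ℤ , 0ℤ) , (0ℤ , 1ℤ)
  quarter₃ = (0ℤ , 1ℤ) , (0ℤ , 1ℤ)
  quarter₄ = (0ℤ , 0ℤ) , (0ℤ , -1ℤ)
  half₀ = (1ℤ , 0ℤ) , (-1ℤ , 0ℤ)
  half₁ = (0ℤ , 1ℤ) , (-1ℤ , 0ℤ)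
  half₂ = (0ℤ , + 2) , (-1ℤ , 0ℤ)
  half₃ = (0ℤ , + 3) , (-1ℤ , 0ℤ)
  half-hyp = (1ℤ , + 2) , (-1ℤ , 0ℤ)

  -- The placements, relative to a tile at position i of its supertile, of the
  -- tiles that can share a segment with it.
  contacts : Fin 5 → List Placement
  contacts 0F = quarter₁ ∷ quarter₂ ∷ quarter₃ ∷ half-hyp ∷ []
  contacts 1F = quarter₁ ∷ half₂ ∷ half-hyp ∷ []
  contacts 2F = quarter₄ ∷ half₁ ∷ half₃ ∷ half-hyp ∷ []
  contacts 3F = half₀ ∷ half₂ ∷ half-hyp ∷ []
  contacts 4F = quarter₃ ∷ half₀ ∷ half₁ ∷ half-hyp ∷ []

  -- `g` is read in the frame of the supertile in which the first tile is `child i`. `Apart` looks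
  -- for a line that meets its first argument at most in a corner; such a line may exist for only
  -- one of the two tiles, hence both orders.
  ApartOrContact : Fin 5 → Placement → Set
  ApartOrContact i g = (Apart (corners (child i)) (corners g) ⊎ Apart (corners g) (corners (child i)))
                     ⊎ Any (λ h → g ≡ child i ⋄ h) (contacts i)

  apartOrContact? : ∀ i g → Dec (ApartOrContact i g)
  apartOrContact? i g = (apart? (corners (child i)) (corners g) ⊎-dec apart? (corners g) (corners (child i)))
                      ⊎-dec any? (λ h → g ≟ₚ (child i ⋄ h)) (contacts i)

  siblings-contact : ∀ i j → i ≢ j → ApartOrContact i (child j)
  siblings-contact = toWitness {a? = Fin.all? λ i → Fin.all? λ j → ¬? (i Fin.≟ j) →-dec apartOrContact? i (child j)} tt

  -- The lists `contacts` reproduce themselves. Here `k` is the position of a supertile in the next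
  -- larger one and `h` leads to another supertile; in the frame of the first, their children are
  -- `child i` and `κ h ⋄ child j`. These are 18 · 25 cases.
  cousins-contact : ∀ k → All (λ h → ∀ i j → ApartOrContact i (κ h ⋄ child j)) (contacts k)
  cousins-contact = toWitness {a? = Fin.all? λ k → all? (λ h → Fin.all? λ i → Fin.all? λ j → apartOrContact? i (κ h ⋄ child j)) (contacts k)} tt

  -- The colours

  infix 4 _≡₁₀_ _≡ᵍ_

  _≡₁₀_ : ℤ → ℤ → Set
  x ≡₁₀ y = ∃[ k ] x ≡ y + k * + 10

  _≡ᵍ_ : Gauss → Gauss → Set
  (x , y) ≡ᵍ (x′ , y′) = x ≡₁₀ x′ × y ≡₁₀ y′

  -- Both remainders lie between 0 and 9 and their difference is a multiple of 10, hence zero.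
  %-cong : ∀ x y → x ≡₁₀ y → x ℤ.%ℕ 10 ≡ y ℤ.%ℕ 10
  %-cong x y (k , x≡) = ℤ.+-injective (ℤ.i-j≡0⇒i≡j (+ r) (+ s) (ℤ.∣i∣≡0⇒i≡0 small))
    where
    r = x ℤ.%ℕ 10
    s = y ℤ.%ℕ 10
    K = y ℤ./ℕ 10 + k - x ℤ./ℕ 10
    rearrange : ∀ r s a b k → r + a * + 10 ≡ s + b * + 10 + k * + 10 → r - s ≡ (b + k - a) * + 10
    rearrange r s a b k e = trans (lhs r s a) (trans (cong (λ t → t - s - a * + 10) e) (rhs s a b k))
      where
      lhs : ∀ r s a → r - s ≡ r + a * + 10 - s - a * + 10
      lhs = solve-∀
      rhs : ∀ s a b k → s + b * + 10 + k * + 10 - s - a * + 10 ≡ (b + k - a) * + 10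
      rhs = solve-∀
    difference : + r - + s ≡ K * + 10
    difference = rearrange (+ r) (+ s) (x ℤ./ℕ 10) (y ℤ./ℕ 10) k
      (trans (sym (ℤ.a≡a%ℕn+[a/ℕn]*n x 10)) (trans x≡ (cong (_+ k * + 10) (ℤ.a≡a%ℕn+[a/ℕn]*n y 10))))
    divisible : 10 ℕ.∣ ℤ.∣ + r - + s ∣
    divisible = ℕ.divides ℤ.∣ K ∣ (trans (cong ℤ.∣_∣ difference) (ℤ.∣i*j∣≡∣i∣*∣j∣ K (+ 10)))
    bound : ℤ.∣ + r - + s ∣ ℕ.< 10
    bound = subst (λ i → ℤ.∣ i ∣ ℕ.< 10) (sym (ℤ.m-n≡m⊖n r s))
      (ℕ.≤-<-trans (ℤ.∣m⊝n∣≤m⊔n r s) (ℕ.⊔-lub (ℤ.n%ℕd<d x 10) (ℤ.n%ℕd<d y 10)))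
    small : ℤ.∣ + r - + s ∣ ≡ 0
    small with ℤ.∣ + r - + s ∣ | divisible | bound
    ... | zero  | _ | _ = refl
    ... | suc n | d | b = contradiction d (ℕ.>⇒∤ b)

  ≡₁₀-% : ∀ x → x ≡₁₀ + (x ℤ.%ℕ 10)
  ≡₁₀-% x = x ℤ./ℕ 10 , ℤ.a≡a%ℕn+[a/ℕn]*n x 10

  -- x + 3y mod 5 is the residue of x + iy modulo 2 + i.  As φ is divisible by
  -- 2 + i, it is determined by the position of the tile in its supertile.
  paint : ℕ → ℕ → Fin 3
  paint x y with (x ℕ.+ 3 ℕ.* y) ℕ.% 5 | x ℕ.% 2 | y ℕ.% 2
  ... | 0 | _ | 0 = 0F
  ... | 0 | _ | _ = 2F
  ... | 4 | 0 | 0 = 1F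
  ... | 4 | 1 | 1 = 1F
  ... | _ | _ | 0 = 2F
  ... | _ | _ | _ = 0F

  col : Gauss → Fin 3
  col (x , y) = paint (x ℤ.%ℕ 10) (y ℤ.%ℕ 10)

  col-cong : ∀ z z′ → z ≡ᵍ z′ → col z ≡ col z′
  col-cong (x , y) (x′ , y′) (p , q) = cong₂ paint (%-cong x x′ p) (%-cong y y′ q)

  -- The quotient a / e: the origin of the lattice, up to sign, seen from the tile.
  origin : Placement → Gauss
  origin (a , e) = conj e ⊠ a

  act : Placement → Gauss → Gauss
  act (b , d) z = conj d ⊠ (z ⊞ b)

  -- (a + e b) / (e d) = conj d (a / e + b), because the inverse of a unit is its conjugate.
  origin-⋄ : ∀ g h → Unit g → origin (g ⋄ h) ≡ act h (origin g)
  origin-⋄ ((a , b) , (p , q)) ((c , d) , (r , s)) u = cong₂ _,_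
    (trans (re a b p q c d r s) (trans (fix (r * x - (- s) * y) (r * c - (- s) * d)) (re′ x y c d r s)))
    (trans (im a b p q c d r s) (trans (fix (r * y + (- s) * x) (r * d + (- s) * c)) (im′ x y c d r s)))
    where
    x = p * a - (- q) * b
    y = p * b + (- q) * a
    fix : ∀ m n → m + (p * p + q * q) * n ≡ m + n
    fix m n = trans (cong (λ k → m + k * n) u) (cong (λ k → m + k) (ℤ.*-identityˡ n))
    re : ∀ a b p q c d r s → (p * r - q * s) * (a + (p * c - q * d)) - (- (p * s + q * r)) * (b + (p * d + q * c))
       ≡ r * (p * a - (- q) * b) - (- s) * (p * b + (- q) * a) + (p * p + q * q) * (r * c - (- s) * d)
    re = solve-∀
    im : ∀ a b p q c d r s → (p * r - q * s) * (b + (p * d + q * c)) + (- (p * s + q * r)) * (a + (p * c - q * d))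
       ≡ r * (p * b + (- q) * a) + (- s) * (p * a - (- q) * b) + (p * p + q * q) * (r * d + (- s) * c)
    im = solve-∀
    re′ : ∀ x y c d r s → r * x - (- s) * y + (r * c - (- s) * d) ≡ r * (x + c) - (- s) * (y + d)
    re′ = solve-∀
    im′ : ∀ x y c d r s → r * y + (- s) * x + (r * d + (- s) * c) ≡ r * (y + d) + (- s) * (x + c)
    im′ = solve-∀

  origin-κ : ∀ g → origin (κ g) ≡ φ (origin g)
  origin-κ ((a , b) , (p , q)) = cong₂ _,_ (re a b p q) (im a b p q)
    where
    re : ∀ a b p q → p * (+ 2 * a + b) - (- (- q)) * (a - + 2 * b) ≡ + 2 * (p * a - (- q) * b) + (p * b + (- q) * a)
    re = solve-∀
    im : ∀ a b p q → p * (a - + 2 * b) + (- (- q)) * (+ 2 * a + b) ≡ p * a - (- q) * b - + 2 * (p * b + (- q) * a)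
    im = solve-∀

  act-cong : ∀ g z z′ → z ≡ᵍ z′ → act g z ≡ᵍ act g z′
  act-cong ((c , d) , (r , s)) (x , y) (x′ , y′) ((k , refl) , (l , refl)) =
    (r * k - (- s) * l , re x′ y′ c d r s k l) , (r * l + (- s) * k , im x′ y′ c d r s k l)
    where
    re : ∀ x y c d r s k l → r * (x + k * + 10 + c) - (- s) * (y + l * + 10 + d)
       ≡ r * (x + c) - (- s) * (y + d) + (r * k - (- s) * l) * + 10
    re = solve-∀
    im : ∀ x y c d r s k l → r * (y + l * + 10 + d) + (- s) * (x + k * + 10 + c)
       ≡ r * (y + d) + (- s) * (x + c) + (r * l + (- s) * k) * + 10
    im = solve-∀

  φ-cong : ∀ z z′ → z ≡ᵍ z′ → φ z ≡ᵍ φ z′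
  φ-cong (x , y) (x′ , y′) ((k , refl) , (l , refl)) = (+ 2 * k + l , re x′ y′ k l) , (k - + 2 * l , im x′ y′ k l)
    where
    re : ∀ x y k l → + 2 * (x + k * + 10) + (y + l * + 10) ≡ + 2 * x + y + (+ 2 * k + l) * + 10
    re = solve-∀
    im : ∀ x y k l → x + k * + 10 - + 2 * (y + l * + 10) ≡ x - + 2 * y + (k - + 2 * l) * + 10
    im = solve-∀

  -- Residues modulo 10 and the finite check of the colours

  Residue : Set
  Residue = Fin 10 × Fin 10

  lift : Residue → Gauss
  lift (x , y) = + toℕ x , + toℕ y

  residue : Gauss → Residue
  residue (x , y) = fromℕ< (ℤ.n%ℕd<d x 10) , fromℕ< (ℤ.n%ℕd<d y 10)

  ≡ᵍ-residue : ∀ z → z ≡ᵍ lift (residue z)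
  ≡ᵍ-residue (x , y) = component x , component y
    where
    component : ∀ x → x ≡₁₀ + toℕ (fromℕ< (ℤ.n%ℕd<d x 10))
    component x = subst (λ n → x ≡₁₀ + n) (sym (Fin.toℕ-fromℕ< (ℤ.n%ℕd<d x 10))) (≡₁₀-% x)

  -- A tile at position `i` has an origin of the form `act (child i) (φ z)`, where z is the origin
  -- of its supertile. Only these origins are tested, for each of the 100 residues of z.
  col-contact-residue : ∀ i → All (λ h → ∀ x y → let z = act (child i) (φ (lift (x , y))) in col z ≢ col (act h z)) (contacts i)
  col-contact-residue = toWitness {a? = Fin.all? λ i → all? (λ h → Fin.all? λ x → Fin.all? λ y →
    let z = act (child i) (φ (lift (x , y))) in ¬? (col z Fin.≟ col (act h z))) (contacts i)} tt

  Contact : ∀ {n} → Address n → Address n → Set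
  Contact []          _ = ⊥
  Contact w@(i ∷ _) v = ∃[ h ] (h ∈ contacts i × pos v ≡ pos w ⋄ h)

  -- Both colours depend on the origin of the supertile of `w` only modulo 10, so its residue may
  -- take its place in the finite check.
  col-contact : ∀ {n} (w v : Address n) → Contact w v → col (origin (pos w)) ≢ col (origin (pos v))
  col-contact w@(i ∷ w′) v (h , h∈ , eq) same =
    All.lookup (col-contact-residue i) h∈ (proj₁ ρ) (proj₂ ρ)
      (trans (sym (col-cong _ z w≡)) (trans same (trans (cong col v≡) (col-cong _ (act h z) (act-cong h _ z w≡)))))
    where
    ρ = residue (origin (pos w′))
    z = act (child i) (φ (lift ρ))
    expand : origin (pos w) ≡ act (child i) (φ (origin (pos w′)))
    expand = trans (origin-⋄ (κ (pos w′)) (child i) (Unit-κ (pos w′) (Unit-pos w′))) (cong (act (child i)) (origin-κ (pos w′)))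
    w≡ : origin (pos w) ≡ᵍ z
    w≡ = subst (_≡ᵍ z) (sym expand) (act-cong (child i) _ (φ (lift ρ)) (φ-cong _ (lift ρ) (≡ᵍ-residue (origin (pos w′)))))
    v≡ : origin (pos v) ≡ act h (origin (pos w))
    v≡ = trans (cong origin eq) (origin-⋄ (pos w) h (Unit-pos w))

module Plane (ℝ : RealNumbers) where
  open RealNumbers ℝ
  open Pinwheel ℝ
  open Placements
  open import Algebra.Properties.AbelianGroup ℤ.+-0-abelianGroup using () renaming (∙-cancelˡ to ℤ-+-cancelˡ)
  open import Algebra.Properties.AbelianGroup +-abelianGroup using (⁻¹-∙-comm) renaming (∙-cancelˡ to +-cancelˡ)
  open import Algebra.Properties.Monoid.Mult +-monoid using (×-homo-+)
  open import Algebra.Properties.Ring ring using (-0#≈0#; -‿involutive; -‿distribˡ-*)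
  open import Algebra.Properties.Semiring.Mult semiring using () renaming (_×_ to _·_)
  open import Relation.Binary.Reasoning.Setoid setoid
  open IsStrictTotalOrder isStrictTotalOrder using (compare) renaming (trans to <-trans; irrefl to <-irrefl; <-resp-≈ to <-resp)

  -- Arithmetic and order of ℝ

  fromℤ-⊖ : ∀ m n → fromℤ (m ℤ.⊖ n) ≈ m · 1# - n · 1#
  fromℤ-⊖ m       zero    = sym (trans (+-congˡ -0#≈0#) (+-identityʳ _))
  fromℤ-⊖ zero    (suc n) = sym (+-identityˡ _)
  fromℤ-⊖ (suc m) (suc n) = begin
    fromℤ (suc m ℤ.⊖ suc n)                ≡⟨ ≡.cong fromℤ (ℤ.[1+m]⊖[1+n]≡m⊖n m n) ⟩
    fromℤ (m ℤ.⊖ n)                        ≈⟨ fromℤ-⊖ m n ⟩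
    m · 1# - n · 1#                        ≈⟨ +-congʳ (+-identityʳ _) ⟨
    m · 1# + 0# - n · 1#                   ≈⟨ +-congʳ (+-congˡ (-‿inverseʳ 1#)) ⟨
    m · 1# + (1# - 1#) - n · 1#            ≈⟨ +-congʳ (+-assoc _ _ _) ⟨
    m · 1# + 1# - 1# - n · 1#              ≈⟨ +-assoc _ _ _ ⟩
    m · 1# + 1# + (- 1# - n · 1#)          ≈⟨ +-cong (+-comm _ _) (⁻¹-∙-comm _ _) ⟩
    1# + m · 1# - (1# + n · 1#)            ∎

  fromℤ-+ : ∀ i j → fromℤ (i ℤ.+ j) ≈ fromℤ i + fromℤ j
  fromℤ-+ (+ m)    (+ n)    = ×-homo-+ 1# m n
  fromℤ-+ (+ m)    -[1+ n ] = fromℤ-⊖ m (suc n)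
  fromℤ-+ -[1+ m ] (+ n)    = trans (fromℤ-⊖ n (suc m)) (+-comm _ _)
  fromℤ-+ -[1+ m ] -[1+ n ] = begin
    - (suc (suc (m ℕ.+ n)) · 1#)           ≡⟨ ≡.cong (λ k → - (k · 1#)) (≡.sym (≡.cong suc (ℕ.+-suc m n))) ⟩
    - ((suc m ℕ.+ suc n) · 1#)             ≈⟨ -‿cong (×-homo-+ 1# (suc m) (suc n)) ⟩
    - (suc m · 1# + suc n · 1#)            ≈⟨ ⁻¹-∙-comm _ _ ⟨
    - (suc m · 1#) - suc n · 1#            ∎

  fromℤ-neg : ∀ i → fromℤ (ℤ.- i) ≈ - fromℤ i
  fromℤ-neg (+ zero)  = sym -0#≈0#
  fromℤ-neg (+ suc n) = refl
  fromℤ-neg -[1+ n ]  = sym (-‿involutive _)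

  fromℤ-*ℕ : ∀ n j → fromℤ (+ n ℤ.* j) ≈ n · 1# * fromℤ j
  fromℤ-*ℕ zero    j = trans (reflexive (≡.cong fromℤ (ℤ.*-zeroˡ j))) (sym (zeroˡ _))
  fromℤ-*ℕ (suc n) j = begin
    fromℤ (+ suc n ℤ.* j)                  ≡⟨ ≡.cong fromℤ (ℤ.suc-* (+ n) j) ⟩
    fromℤ (j ℤ.+ + n ℤ.* j)                ≈⟨ fromℤ-+ j (+ n ℤ.* j) ⟩
    fromℤ j + fromℤ (+ n ℤ.* j)            ≈⟨ +-cong (sym (*-identityˡ _)) (fromℤ-*ℕ n j) ⟩
    1# * fromℤ j + n · 1# * fromℤ j        ≈⟨ distribʳ _ _ _ ⟨
    (1# + n · 1#) * fromℤ j                ∎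

  fromℤ-* : ∀ i j → fromℤ (i ℤ.* j) ≈ fromℤ i * fromℤ j
  fromℤ-* (+ n)    j = fromℤ-*ℕ n j
  fromℤ-* -[1+ n ] j = begin
    fromℤ (-[1+ n ] ℤ.* j)                 ≡⟨ ≡.cong fromℤ (ℤ.neg-distribˡ-* (+ suc n) j) ⟨
    fromℤ (ℤ.- (+ suc n ℤ.* j))            ≈⟨ fromℤ-neg (+ suc n ℤ.* j) ⟩
    - fromℤ (+ suc n ℤ.* j)                ≈⟨ -‿cong (fromℤ-*ℕ (suc n) j) ⟩
    - (suc n · 1# * fromℤ j)               ≈⟨ -‿distribˡ-* _ _ ⟩
    - (suc n · 1#) * fromℤ j               ∎

  -- Gives the ring solver integer constants. Since `fromℤ 1ℤ` unfolds to `1# + 0#`, the constant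
  -- `con 1ℤ` is not literally `1#`; for this reason `1#` often enters the solver as a variable, and
  -- the law `1# * x ≈ x` is applied separately.
  fromℤ-homomorphism : ℤ.+-*-rawRing -Raw-AlmostCommutative⟶ fromCommutativeRing commutativeRing
  fromℤ-homomorphism = record
    { ⟦_⟧    = fromℤ
    ; +-homo = fromℤ-+
    ; *-homo = fromℤ-*
    ; -‿homo = fromℤ-neg
    ; 0-homo = refl
    ; 1-homo = +-identityʳ 1#
    }

  open import Algebra.Solver.Ring ℤ.+-*-rawRing (fromCommutativeRing commutativeRing) fromℤ-homomorphism
    (λ i j → Maybe.map (reflexive ∘ ≡.cong fromℤ) (dec⇒maybe (i ℤ.≟ j)))

  <-respʳ : ∀ {x y z} → y ≈ z → x < y → x < z
  <-respʳ = proj₁ <-resp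
  <-respˡ : ∀ {x y z} → x ≈ z → x < y → z < y
  <-respˡ = proj₂ <-resp

  ≤-respʳ : ∀ {x y z} → y ≈ z → x ≤ y → x ≤ z
  ≤-respʳ e (inj₁ p) = inj₁ (<-respʳ e p)
  ≤-respʳ e (inj₂ p) = inj₂ (trans p e)

  <⇒≉ : ∀ {x y} → x < y → ¬ x ≈ y
  <⇒≉ p e = <-irrefl e p

  ≤-<-trans : ∀ {x y z} → x ≤ y → y < z → x < z
  ≤-<-trans (inj₁ p) q = <-trans p q
  ≤-<-trans (inj₂ e) q = <-respˡ (sym e) q

  ≤⇒≯ : ∀ {x y} → x ≤ y → ¬ y < x
  ≤⇒≯ p q = <-irrefl refl (≤-<-trans p q)

  pos+nonNeg : ∀ {x y} → 0# < x → 0# ≤ y → 0# < x + y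
  pos+nonNeg {x} {y} p (inj₁ q) = <-trans q (<-respˡ (+-identityˡ y) (+-monoˡ-< y p))
  pos+nonNeg {x} {y} p (inj₂ q) = <-respʳ (trans (sym (+-identityʳ x)) (+-congˡ q)) p

  nonNeg+pos : ∀ {x y} → 0# ≤ x → 0# < y → 0# < x + y
  nonNeg+pos p q = <-respʳ (+-comm _ _) (pos+nonNeg q p)

  nonNeg+nonNeg : ∀ {x y} → 0# ≤ x → 0# ≤ y → 0# ≤ x + y
  nonNeg+nonNeg (inj₁ p) q = inj₁ (pos+nonNeg p q)
  nonNeg+nonNeg {x} {y} (inj₂ p) q = ≤-respʳ (trans (sym (+-identityˡ y)) (+-congʳ p)) q

  nonNeg*nonNeg : ∀ {x y} → 0# ≤ x → 0# ≤ y → 0# ≤ x * y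
  nonNeg*nonNeg (inj₁ p) (inj₁ q) = inj₁ (*-pos p q)
  nonNeg*nonNeg (inj₂ p) _        = inj₂ (trans (sym (zeroˡ _)) (*-congʳ p))
  nonNeg*nonNeg (inj₁ _) (inj₂ q) = inj₂ (trans (sym (zeroʳ _)) (*-congˡ q))

  <⇒0<- : ∀ {x y} → x < y → 0# < y - x
  <⇒0<- {x} p = <-respˡ (-‿inverseʳ x) (+-monoˡ-< (- x) p)

  ≤⇒0≤- : ∀ {x y} → x ≤ y → 0# ≤ y - x
  ≤⇒0≤- (inj₁ p) = inj₁ (<⇒0<- p)
  ≤⇒0≤- {x} (inj₂ e) = inj₂ (trans (sym (-‿inverseʳ x)) (+-congʳ e))

  0≤x*x : ∀ x → 0# ≤ x * x
  0≤x*x x with compare 0# x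
  ... | tri< p _ _ = inj₁ (*-pos p p)
  ... | tri≈ _ e _ = nonNeg*nonNeg (inj₂ e) (inj₂ e)
  ... | tri> _ _ p = inj₁ (<-respʳ (solve 1 (λ x → (con (+ 0) :- x) :* (con (+ 0) :- x) := x :* x) refl x) (*-pos (<⇒0<- p) (<⇒0<- p)))

  nonNeg+nonNeg≈0ˡ : ∀ {x y} → 0# ≤ x → 0# ≤ y → x + y ≈ 0# → x ≈ 0#
  nonNeg+nonNeg≈0ˡ (inj₁ p) q e = contradiction (sym e) (<⇒≉ (pos+nonNeg p q))
  nonNeg+nonNeg≈0ˡ (inj₂ p) q e = sym p

  pos⇒≉0 : ∀ {x} → 0# < x → ¬ x ≈ 0#
  pos⇒≉0 p e = <⇒≉ p (sym e)

  x*y≈0⇒y≈0 : ∀ {x y} → ¬ x ≈ 0# → x * y ≈ 0# → y ≈ 0#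
  x*y≈0⇒y≈0 {x} {y} x≉0 e = begin
    y                ≈⟨ *-identityˡ y ⟨
    1# * y           ≈⟨ *-congʳ (⁻¹-inverseʳ x x≉0) ⟨
    x * x ⁻¹ * y     ≈⟨ solve 3 (λ a b c → a :* b :* c := b :* (a :* c)) refl x (x ⁻¹) y ⟩
    x ⁻¹ * (x * y)   ≈⟨ *-congˡ e ⟩
    x ⁻¹ * 0#        ≈⟨ zeroʳ _ ⟩
    0#               ∎

  x-y≈0⇒x≈y : ∀ {x y} → x - y ≈ 0# → x ≈ y
  x-y≈0⇒x≈y {x} {y} e = begin
    x          ≈⟨ solve 2 (λ x y → x := (x :- y) :+ y) refl x y ⟩
    x - y + y  ≈⟨ +-congʳ e ⟩
    0# + y     ≈⟨ +-identityˡ y ⟩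
    y          ∎

  *-cancelˡ : ∀ {a x y} → ¬ a ≈ 0# → a * x ≈ a * y → x ≈ y
  *-cancelˡ {a} {x} {y} a≉0 e = x-y≈0⇒x≈y (x*y≈0⇒y≈0 a≉0 (begin
    a * (x - y)    ≈⟨ solve 3 (λ a x y → a :* (x :- y) := a :* x :- a :* y) refl a x y ⟩
    a * x - a * y  ≈⟨ +-congʳ e ⟩
    a * y - a * y  ≈⟨ -‿inverseʳ _ ⟩
    0#             ∎))

  x*x≈0⇒x≈0 : ∀ {x} → x * x ≈ 0# → x ≈ 0#
  x*x≈0⇒x≈0 {x} e with compare 0# x
  ... | tri≈ _ q _ = sym q
  ... | tri< _ q _ = x*y≈0⇒y≈0 (λ z → q (sym z)) e
  ... | tri> _ q _ = x*y≈0⇒y≈0 (λ z → q (sym z)) e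

  0<fromℤ-suc : ∀ n → 0# < fromℤ (+ suc n)
  0≤fromℤ     : ∀ n → 0# ≤ fromℤ (+ n)
  0<fromℤ-suc n       = pos+nonNeg 0<1 (0≤fromℤ n)
  0≤fromℤ zero    = inj₂ refl
  0≤fromℤ (suc n) = inj₁ (0<fromℤ-suc n)

  fromℤ-minus : ∀ i j → fromℤ (i ℤ.- j) ≈ fromℤ i - fromℤ j
  fromℤ-minus i j = trans (fromℤ-+ i (ℤ.- j)) (+-congˡ (fromℤ-neg j))

  fromℤ-mono-≤ : ∀ {i j} → i ℤ.≤ j → 0# ≤ fromℤ j - fromℤ i
  fromℤ-mono-≤ {i} {j} i≤j with j ℤ.- i in eq | ℤ.i≤j⇒0≤j-i i≤j
  ... | + n | _ = ≤-respʳ (trans (reflexive (≡.cong fromℤ (≡.sym eq))) (fromℤ-minus j i)) (0≤fromℤ n)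

  fromℤ-mono-< : ∀ {i j} → i ℤ.< j → 0# < fromℤ j - fromℤ i
  fromℤ-mono-< {i} {j} i<j = <-respʳ shift (pos+nonNeg 0<1 (fromℤ-mono-≤ (ℤ.i<j⇒suc[i]≤j i<j)))
    where
    shift : 1# + (fromℤ j - fromℤ (ℤ.suc i)) ≈ fromℤ j - fromℤ i
    shift = trans (+-congˡ (+-congˡ (-‿cong (trans (fromℤ-+ (+ 1) i) (+-congʳ (+-identityʳ 1#))))))
                  (solve 3 (λ o x y → o :+ (y :- (o :+ x)) := y :- x) refl 1# (fromℤ i) (fromℤ j))

  fromℤ-injective : ∀ {i j} → fromℤ i ≈ fromℤ j → i ≡ j
  fromℤ-injective {i} {j} e with ℤ.<-cmp i j
  ... | tri≈ _ q _ = q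
  ... | tri< p _ _ = contradiction (trans (+-congʳ (sym e)) (-‿inverseʳ _)) (pos⇒≉0 (fromℤ-mono-< p))
  ... | tri> _ _ p = contradiction (trans (+-congʳ e) (-‿inverseʳ _)) (pos⇒≉0 (fromℤ-mono-< p))

  -- Frames

  open Setoid pointSetoid using () renaming (refl to ≈ₚ-refl; sym to ≈ₚ-sym; trans to ≈ₚ-trans; reflexive to ≈ₚ-reflexive) public
  open Setoid triangleSetoid using () renaming (refl to ≈△-refl; sym to ≈△-sym; trans to ≈△-trans; reflexive to ≈△-reflexive) public

  -- A triangle also serves as a coordinate frame: its origin and the tips of its two axes.
  at : Triangle → Carrier → Carrier → Point
  at (P , Q , R) x y = P ⊕ x ∙ (Q ⊖ P) ⊕ y ∙ (R ⊖ P)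

  pt : Triangle → Gauss → Point
  pt F (x , y) = at F (fromℤ x) (fromℤ y)

  tri : Triangle → Corners → Triangle
  tri F (a , b , c) = pt F a , pt F b , pt F c

  tile : Triangle → Placement → Triangle
  tile F g = tri F (corners g)

  infixl 6 _▹_
  _▹_ : Triangle → Placement → Triangle
  F ▹ ((a , b) , (p , q)) = pt F (a , b) , pt F (a ℤ.+ p , b ℤ.+ q) , pt F (a ℤ.- q , b ℤ.+ p)

  ⊕-cong : ∀ {p p′ q q′} → p ≈ₚ p′ → q ≈ₚ q′ → p ⊕ q ≈ₚ p′ ⊕ q′
  ⊕-cong (e , e′) (f , f′) = +-cong e f , +-cong e′ f′

  ⊖-cong : ∀ {p p′ q q′} → p ≈ₚ p′ → q ≈ₚ q′ → p ⊖ q ≈ₚ p′ ⊖ q′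
  ⊖-cong (e , e′) (f , f′) = +-cong e (-‿cong f) , +-cong e′ (-‿cong f′)

  ∙-cong : ∀ {x x′ p p′} → x ≈ x′ → p ≈ₚ p′ → x ∙ p ≈ₚ x′ ∙ p′
  ∙-cong e (f , f′) = *-cong e f , *-cong e f′

  at-cong : ∀ {F G x x′ y y′} → F ≈△ G → x ≈ x′ → y ≈ y′ → at F x y ≈ₚ at G x′ y′
  at-cong (e , f , g) h k = ⊕-cong (⊕-cong e (∙-cong h (⊖-cong f e))) (∙-cong k (⊖-cong g e))

  pt-cong : ∀ {F G} z → F ≈△ G → pt F z ≈ₚ pt G z
  pt-cong z e = at-cong e refl refl

  tri-cong : ∀ {F G} τ → F ≈△ G → tri F τ ≈△ tri G τ
  tri-cong (a , b , c) e = pt-cong a e , pt-cong b e , pt-cong c e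

  dist²-cong : ∀ {p p′ q q′} → p ≈ₚ p′ → q ≈ₚ q′ → dist² p q ≈ dist² p′ q′
  dist²-cong e f with ⊖-cong e f
  ... | (g , h) = +-cong (*-cong g g) (*-cong h h)

  pt-▹ : ∀ F g z → pt (F ▹ g) z ≈ₚ pt F (apply g z)
  pt-▹ F@((p₁ , p₂) , (q₁ , q₂) , (r₁ , r₂)) g@((a , b) , (p , q)) z@(x , y) =
    ≈ₚ-trans (at-cong (≈ₚ-refl , at-cong ≈△-refl (fromℤ-+ a p) (fromℤ-+ b q) , at-cong ≈△-refl (fromℤ-minus a q) (fromℤ-+ b p)) refl refl)
   (≈ₚ-trans (nested p₁ (q₁ - p₁) (r₁ - p₁) , nested p₂ (q₂ - p₂) (r₂ - p₂))
             (at-cong ≈△-refl (sym re) (sym im)))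
    where
    A B P Q X Y : Carrier
    A = fromℤ a
    B = fromℤ b
    P = fromℤ p
    Q = fromℤ q
    X = fromℤ x
    Y = fromℤ y
    re : fromℤ (a ℤ.+ (p ℤ.* x ℤ.- q ℤ.* y)) ≈ A + (P * X - Q * Y)
    re = trans (fromℤ-+ a _) (+-congˡ (trans (fromℤ-minus (p ℤ.* x) _) (+-cong (fromℤ-* p x) (-‿cong (fromℤ-* q y)))))
    im : fromℤ (b ℤ.+ (p ℤ.* y ℤ.+ q ℤ.* x)) ≈ B + (P * Y + Q * X)
    im = trans (fromℤ-+ b _) (+-congˡ (trans (fromℤ-+ (p ℤ.* y) _) (+-cong (fromℤ-* p y) (fromℤ-* q x))))
    nested : ∀ o u v → o + A * u + B * v + X * (o + (A + P) * u + (B + Q) * v - (o + A * u + B * v))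
                                         + Y * (o + (A - Q) * u + (B + P) * v - (o + A * u + B * v))
                     ≈ o + (A + (P * X - Q * Y)) * u + (B + (P * Y + Q * X)) * v
    nested o u v = solve 9 (λ A B P Q X Y o u v →
      o :+ A :* u :+ B :* v :+ X :* (o :+ (A :+ P) :* u :+ (B :+ Q) :* v :- (o :+ A :* u :+ B :* v))
                            :+ Y :* (o :+ (A :- Q) :* u :+ (B :+ P) :* v :- (o :+ A :* u :+ B :* v))
      := o :+ (A :+ (P :* X :- Q :* Y)) :* u :+ (B :+ (P :* Y :+ Q :* X)) :* v) refl A B P Q X Y o u v

  tile-▹ : ∀ F g h → tile (F ▹ g) h ≈△ tile F (g ⋄ h)
  tile-▹ F g h = ≈△-trans (pt-▹ F g _ , pt-▹ F g _ , pt-▹ F g _) (≈△-reflexive (≡.cong (tri F) (≡.sym (corners-⋄ g h))))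

  -- The last field is Pythagoras' theorem: isometries are given by distances, not
  -- by inner products.
  record Orthogonal (s : Carrier) (F : Triangle) : Set where
    constructor orthogonal
    private
      P = proj₁ F
      Q = proj₁ (proj₂ F)
      R = proj₂ (proj₂ F)
    field
      PQ : dist² P Q ≈ s
      PR : dist² P R ≈ s
      QR : dist² Q R ≈ s + s

  open Orthogonal

  -- Polarization: the mixed term has the coefficient PQ + PR - QR, twice the inner product of the
  -- axes, which is s + s - (s + s).
  dist²-at : ∀ {s F} → Orthogonal s F → ∀ x y x′ y′ →
             dist² (at F x y) (at F x′ y′) ≈ s * ((x - x′) * (x - x′) + (y - y′) * (y - y′))
  dist²-at {s} {F@((p₁ , p₂) , (q₁ , q₂) , (r₁ , r₂))} o x y x′ y′ = begin
    dist² (at F x y) (at F x′ y′)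
      ≈⟨ +-cong (*-cong (difference p₁ _ _) (difference p₁ _ _)) (*-cong (difference p₂ _ _) (difference p₂ _ _)) ⟩
    (X * (q₁ - p₁) + Y * (r₁ - p₁)) * (X * (q₁ - p₁) + Y * (r₁ - p₁)) + (X * (q₂ - p₂) + Y * (r₂ - p₂)) * (X * (q₂ - p₂) + Y * (r₂ - p₂))
      ≈⟨ +-cong (square p₁ q₁ r₁) (square p₂ q₂ r₂) ⟩
    S (p₁ - q₁) (p₁ - r₁) (q₁ - r₁) + S (p₂ - q₂) (p₂ - r₂) (q₂ - r₂)
      ≈⟨ solve 8 (λ X Y a b c a′ b′ c′ → X :* X :* (a :* a) :+ Y :* Y :* (b :* b) :+ X :* Y :* (a :* a :+ b :* b :- c :* c)
                                   :+ (X :* X :* (a′ :* a′) :+ Y :* Y :* (b′ :* b′) :+ X :* Y :* (a′ :* a′ :+ b′ :* b′ :- c′ :* c′))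
                      := X :* X :* (a :* a :+ a′ :* a′) :+ Y :* Y :* (b :* b :+ b′ :* b′)
                         :+ X :* Y :* (a :* a :+ a′ :* a′ :+ (b :* b :+ b′ :* b′) :- (c :* c :+ c′ :* c′))) refl X Y _ _ _ _ _ _ ⟩
    X * X * dist² P Q + Y * Y * dist² P R + X * Y * (dist² P Q + dist² P R - dist² Q R)
      ≈⟨ +-cong (+-cong (*-congˡ (PQ o)) (*-congˡ (PR o))) (*-congˡ (+-cong (+-cong (PQ o) (PR o)) (-‿cong (QR o)))) ⟩
    X * X * s + Y * Y * s + X * Y * (s + s - (s + s))
      ≈⟨ solve 3 (λ X Y s → X :* X :* s :+ Y :* Y :* s :+ X :* Y :* (s :+ s :- (s :+ s)) := s :* (X :* X :+ Y :* Y)) refl X Y s ⟩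
    s * (X * X + Y * Y) ∎
    where
    X Y : Carrier
    X = x - x′
    Y = y - y′
    P Q R : Point
    P = (p₁ , p₂)
    Q = (q₁ , q₂)
    R = (r₁ , r₂)
    S : Carrier → Carrier → Carrier → Carrier
    S a b c = X * X * (a * a) + Y * Y * (b * b) + X * Y * (a * a + b * b - c * c)
    difference : ∀ o u v → o + x * u + y * v - (o + x′ * u + y′ * v) ≈ X * u + Y * v
    difference = solve 7 (λ x y x′ y′ o u v → o :+ x :* u :+ y :* v :- (o :+ x′ :* u :+ y′ :* v) := (x :- x′) :* u :+ (y :- y′) :* v) refl x y x′ y′
    square : ∀ p q r → (X * (q - p) + Y * (r - p)) * (X * (q - p) + Y * (r - p)) ≈ S (p - q) (p - r) (q - r)
    square = solve 5 (λ X Y p q r → (X :* (q :- p) :+ Y :* (r :- p)) :* (X :* (q :- p) :+ Y :* (r :- p))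
      := X :* X :* ((p :- q) :* (p :- q)) :+ Y :* Y :* ((p :- r) :* (p :- r))
         :+ X :* Y :* ((p :- q) :* (p :- q) :+ (p :- r) :* (p :- r) :- (q :- r) :* (q :- r))) refl X Y

  dist²-pt : ∀ {s F} → Orthogonal s F → ∀ z z′ → dist² (pt F z) (pt F z′) ≈ s * fromℤ (norm (z ⊞ neg z′))
  dist²-pt {s} {F} o (x , y) (x′ , y′) = trans (dist²-at o (fromℤ x) (fromℤ y) (fromℤ x′) (fromℤ y′))
    (*-congˡ (sym (trans (fromℤ-+ ((x ℤ.- x′) ℤ.* (x ℤ.- x′)) _) (+-cong (square x x′) (square y y′)))))
    where
    square : ∀ i j → fromℤ ((i ℤ.- j) ℤ.* (i ℤ.- j)) ≈ (fromℤ i - fromℤ j) * (fromℤ i - fromℤ j)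
    square i j = trans (fromℤ-* (i ℤ.- j) _) (*-cong (fromℤ-minus i j) (fromℤ-minus i j))

  Orthogonal-▹ : ∀ {s F} g → Orthogonal s F → Unit g → Orthogonal s (F ▹ g)
  Orthogonal-▹ {s} {F} g@((a , b) , (p , q)) o u = orthogonal
    (length (a , b) (a ℤ.+ p , b ℤ.+ q) (≡.trans (e₁ a b p q) u))
    (length (a , b) (a ℤ.- q , b ℤ.+ p) (≡.trans (e₂ a b p q) u))
    (trans (dist²-pt o (a ℤ.+ p , b ℤ.+ q) (a ℤ.- q , b ℤ.+ p)) (trans (*-congˡ (reflexive (≡.cong fromℤ (≡.trans (e₃ a b p q) (≡.cong (+ 2 ℤ.*_) u))))) double))
    where
    length : ∀ z z′ → norm (z ⊞ neg z′) ≡ 1ℤ → dist² (pt F z) (pt F z′) ≈ s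
    length z z′ e = trans (dist²-pt o z z′) (trans (*-congˡ (trans (reflexive (≡.cong fromℤ e)) (+-identityʳ 1#))) (*-identityʳ s))
    double : s * (1# + (1# + 0#)) ≈ s + s
    double = trans (*-congˡ (+-congˡ (+-identityʳ 1#))) (trans (distribˡ s 1# 1#) (+-cong (*-identityʳ s) (*-identityʳ s)))
    e₁ : ∀ a b p q → (a ℤ.+ ℤ.- (a ℤ.+ p)) ℤ.* (a ℤ.+ ℤ.- (a ℤ.+ p)) ℤ.+ (b ℤ.+ ℤ.- (b ℤ.+ q)) ℤ.* (b ℤ.+ ℤ.- (b ℤ.+ q)) ≡ p ℤ.* p ℤ.+ q ℤ.* q
    e₁ = solve-∀
    e₂ : ∀ a b p q → (a ℤ.+ ℤ.- (a ℤ.- q)) ℤ.* (a ℤ.+ ℤ.- (a ℤ.- q)) ℤ.+ (b ℤ.+ ℤ.- (b ℤ.+ p)) ℤ.* (b ℤ.+ ℤ.- (b ℤ.+ p)) ≡ p ℤ.* p ℤ.+ q ℤ.* q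
    e₂ = solve-∀
    e₃ : ∀ a b p q → (a ℤ.+ p ℤ.+ ℤ.- (a ℤ.- q)) ℤ.* (a ℤ.+ p ℤ.+ ℤ.- (a ℤ.- q)) ℤ.+ (b ℤ.+ q ℤ.+ ℤ.- (b ℤ.+ p)) ℤ.* (b ℤ.+ q ℤ.+ ℤ.- (b ℤ.+ p)) ≡ + 2 ℤ.* (p ℤ.* p ℤ.+ q ℤ.* q)
    e₃ = solve-∀

  -- Convexity

  ∈△-cong : ∀ {p t u} → t ≈△ u → p ∈△ t → p ∈△ u
  ∈△-cong (e , f , g) (α , β , γ , α≥0 , β≥0 , γ≥0 , sum , eq) =
    α , β , γ , α≥0 , β≥0 , γ≥0 , sum , ≈ₚ-trans eq (⊕-cong (⊕-cong (∙-cong refl e) (∙-cong refl f)) (∙-cong refl g))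

  ∈int-cong : ∀ {p t u} → t ≈△ u → p ∈int t → p ∈int u
  ∈int-cong (e , f , g) (α , β , γ , α>0 , β>0 , γ>0 , sum , eq) =
    α , β , γ , α>0 , β>0 , γ>0 , sum , ≈ₚ-trans eq (⊕-cong (⊕-cong (∙-cong refl e) (∙-cong refl f)) (∙-cong refl g))

  combine : Carrier → Carrier → Carrier → Triangle → Point
  combine α β γ (a , b , c) = α ∙ a ⊕ β ∙ b ⊕ γ ∙ c

  mix : Carrier → Carrier → Carrier → Carrier → Carrier → Carrier → Carrier
  mix α β γ x y z = α * x + β * y + γ * z

  combine-combine : ∀ α β γ (t : Triangle) (l m n : Carrier × Carrier × Carrier) →
    let (l₁ , l₂ , l₃) = l ; (m₁ , m₂ , m₃) = m ; (n₁ , n₂ , n₃) = n in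
    combine α β γ (combine l₁ l₂ l₃ t , combine m₁ m₂ m₃ t , combine n₁ n₂ n₃ t)
      ≈ₚ combine (mix α β γ l₁ m₁ n₁) (mix α β γ l₂ m₂ n₂) (mix α β γ l₃ m₃ n₃) t
  combine-combine α β γ ((a , a′) , (b , b′) , (c , c′)) (l₁ , l₂ , l₃) (m₁ , m₂ , m₃) (n₁ , n₂ , n₃) = coordinate a b c , coordinate a′ b′ c′
    where
    coordinate : ∀ a b c → mix α β γ (mix l₁ l₂ l₃ a b c) (mix m₁ m₂ m₃ a b c) (mix n₁ n₂ n₃ a b c)
               ≈ mix (mix α β γ l₁ m₁ n₁) (mix α β γ l₂ m₂ n₂) (mix α β γ l₃ m₃ n₃) a b c
    coordinate = solve 15 (λ α β γ l₁ l₂ l₃ m₁ m₂ m₃ n₁ n₂ n₃ a b c →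
      let mx : _ → _ → _ → _ → _ → _ → _
          mx x y z u v w = x :* u :+ y :* v :+ z :* w in
      mx α β γ (mx l₁ l₂ l₃ a b c) (mx m₁ m₂ m₃ a b c) (mx n₁ n₂ n₃ a b c)
        := mx (mx α β γ l₁ m₁ n₁) (mx α β γ l₂ m₂ n₂) (mx α β γ l₃ m₃ n₃) a b c) refl
      α β γ l₁ l₂ l₃ m₁ m₂ m₃ n₁ n₂ n₃

  -- φ applied to the corners of one.
  supertile : Corners
  supertile = (0ℤ , 0ℤ) , (+ 2 , 1ℤ) , (+ 2 , -[1+ 3 ])

  -- Ten times the barycentric coordinates with respect to supertile.
  weight : Fin 3 → Gauss → ℤ
  weight 0F (x , y) = + 10 ℤ.- + 5 ℤ.* x
  weight 1F (x , y) = + 4 ℤ.* x ℤ.+ + 2 ℤ.* y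
  weight 2F (x , y) = x ℤ.- + 2 ℤ.* y

  corner : Fin 3 → Corners → Gauss
  corner 0F (a , b , c) = a
  corner 1F (a , b , c) = b
  corner 2F (a , b , c) = c

  weights-nonNeg : ∀ i v k → 0ℤ ℤ.≤ weight k (corner v (corners (child i)))
  weights-nonNeg = toWitness {a? = Fin.all? λ i → Fin.all? λ v → Fin.all? λ k → 0ℤ ℤ.≤? weight k (corner v (corners (child i)))} tt

  -- No child lies in a side of the supertile. Therefore a combination of its corners with positive
  -- coefficients has three positive weights, and interior points of the child are interior in the
  -- supertile.
  weights-pos : ∀ i k → ∃[ v ] 0ℤ ℤ.< weight k (corner v (corners (child i)))
  weights-pos = toWitness {a? = Fin.all? λ i → Fin.all? λ k → Fin.any? λ v → 0ℤ ℤ.<? weight k (corner v (corners (child i)))} tt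

  fromℤ-nonNeg : ∀ {i} → 0ℤ ℤ.≤ i → 0# ≤ fromℤ i
  fromℤ-nonNeg {i} p = ≤-respʳ (solve 1 (λ x → x :- con (+ 0) := x) refl (fromℤ i)) (fromℤ-mono-≤ p)

  fromℤ-pos : ∀ {i} → 0ℤ ℤ.< i → 0# < fromℤ i
  fromℤ-pos {i} p = <-respʳ (solve 1 (λ x → x :- con (+ 0) := x) refl (fromℤ i)) (fromℤ-mono-< p)

  fromℤ-suc≉0 : ∀ n → ¬ fromℤ (+ suc n) ≈ 0#
  fromℤ-suc≉0 n = pos⇒≉0 (0<fromℤ-suc n)

  -- `x ⁻¹` is `x` times the square of `x ⁻¹`, which is not zero because 1 is not.
  0<x⇒0<x⁻¹ : ∀ {x} → 0# < x → 0# < x ⁻¹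
  0<x⇒0<x⁻¹ {x} x>0 = <-respʳ square (*-pos x>0 (0<x*x (λ e → pos⇒≉0 0<1 (trans (sym (⁻¹-inverseʳ x x≉0)) (trans (*-congˡ e) (zeroʳ x))))))
    where
    x≉0 = pos⇒≉0 x>0
    0<x*x : ∀ {y} → ¬ y ≈ 0# → 0# < y * y
    0<x*x {y} y≉0 with 0≤x*x y
    ... | inj₁ p = p
    ... | inj₂ e = contradiction (x*x≈0⇒x≈0 (sym e)) y≉0
    square : x * (x ⁻¹ * x ⁻¹) ≈ x ⁻¹
    square = trans (sym (*-assoc x _ _)) (trans (*-congʳ (⁻¹-inverseʳ x x≉0)) (*-identityˡ _))

  tenth : Carrier
  tenth = fromℤ (+ 10) ⁻¹

  ten-tenth : fromℤ (+ 10) * tenth ≈ 1#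
  ten-tenth = ⁻¹-inverseʳ _ (fromℤ-suc≉0 9)

  0<tenth : 0# < tenth
  0<tenth = 0<x⇒0<x⁻¹ (0<fromℤ-suc 9)

  bary : Fin 3 → Gauss → Carrier
  bary k z = tenth * fromℤ (weight k z)

  scale-tenth : ∀ {x y} → x ≈ fromℤ (+ 10) * tenth * y → x ≈ y
  scale-tenth e = trans e (trans (*-congʳ ten-tenth) (*-identityˡ _))

  fromℤ-weight : ∀ (z : Gauss) → let (x , y) = z in
    fromℤ (weight 0F z) ≈ fromℤ (+ 10) - fromℤ (+ 5) * fromℤ x ×
    fromℤ (weight 1F z) ≈ fromℤ (+ 4) * fromℤ x + fromℤ (+ 2) * fromℤ y ×
    fromℤ (weight 2F z) ≈ fromℤ x - fromℤ (+ 2) * fromℤ y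
  fromℤ-weight (x , y) =
    trans (fromℤ-minus (+ 10) (+ 5 ℤ.* x)) (+-congˡ (-‿cong (fromℤ-* (+ 5) x))) ,
    trans (fromℤ-+ (+ 4 ℤ.* x) _) (+-cong (fromℤ-* (+ 4) x) (fromℤ-* (+ 2) y)) ,
    trans (fromℤ-minus x (+ 2 ℤ.* y)) (+-congˡ (-‿cong (fromℤ-* (+ 2) y)))

  bary-sum : ∀ z → bary 0F z + bary 1F z + bary 2F z ≈ 1#
  bary-sum z@(x , y) with fromℤ-weight z
  ... | e , f , g = scale-tenth (trans (+-cong (+-cong (*-congˡ e) (*-congˡ f)) (*-congˡ g))
    (trans (solve 3 (λ t x y → t :* (con (+ 10) :- con (+ 5) :* x) :+ t :* (con (+ 4) :* x :+ con (+ 2) :* y) :+ t :* (x :- con (+ 2) :* y)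
             := con (+ 10) :* t :* con (+ 1)) refl tenth (fromℤ x) (fromℤ y)) (*-congˡ (+-identityʳ 1#))))

  pt-bary : ∀ F z → pt F z ≈ₚ combine (bary 0F z) (bary 1F z) (bary 2F z) (tri F supertile)
  pt-bary F@((p₁ , p₂) , (q₁ , q₂) , (r₁ , r₂)) z@(x , y) with fromℤ-weight z
  ... | e , f , g = coordinate p₁ (q₁ - p₁) (r₁ - p₁) , coordinate p₂ (q₂ - p₂) (r₂ - p₂)
    where
    coordinate : ∀ o u v → o + fromℤ x * u + fromℤ y * v
      ≈ mix (bary 0F z) (bary 1F z) (bary 2F z) (o + fromℤ 0ℤ * u + fromℤ 0ℤ * v) (o + fromℤ (+ 2) * u + fromℤ 1ℤ * v) (o + fromℤ (+ 2) * u + fromℤ -[1+ 3 ] * v)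
    coordinate o u v = sym (scale-tenth (trans (+-cong (+-cong (*-congʳ (*-congˡ e)) (*-congʳ (*-congˡ f))) (*-congʳ (*-congˡ g)))
      (solve 6 (λ t x y o u v →
        t :* (con (+ 10) :- con (+ 5) :* x) :* (o :+ con 0ℤ :* u :+ con 0ℤ :* v)
        :+ t :* (con (+ 4) :* x :+ con (+ 2) :* y) :* (o :+ con (+ 2) :* u :+ con 1ℤ :* v)
        :+ t :* (x :- con (+ 2) :* y) :* (o :+ con (+ 2) :* u :+ con -[1+ 3 ] :* v)
        := con (+ 10) :* t :* (o :+ x :* u :+ y :* v)) refl tenth (fromℤ x) (fromℤ y) o u v)))

  mix-nonNeg : ∀ {α β γ x y z} → 0# ≤ α → 0# ≤ β → 0# ≤ γ → 0# ≤ x → 0# ≤ y → 0# ≤ z → 0# ≤ mix α β γ x y z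
  mix-nonNeg p q r a b c = nonNeg+nonNeg (nonNeg+nonNeg (nonNeg*nonNeg p a) (nonNeg*nonNeg q b)) (nonNeg*nonNeg r c)

  mix-pos : ∀ {α β γ} (x : Fin 3 → Carrier) → 0# < α → 0# < β → 0# < γ → (∀ v → 0# ≤ x v) → (∃[ v ] 0# < x v) →
            0# < mix α β γ (x 0F) (x 1F) (x 2F)
  mix-pos x p q r h (0F , k) = pos+nonNeg (pos+nonNeg (*-pos p k) (nonNeg*nonNeg (inj₁ q) (h 1F))) (nonNeg*nonNeg (inj₁ r) (h 2F))
  mix-pos x p q r h (1F , k) = pos+nonNeg (nonNeg+pos (nonNeg*nonNeg (inj₁ p) (h 0F)) (*-pos q k)) (nonNeg*nonNeg (inj₁ r) (h 2F))
  mix-pos x p q r h (2F , k) = nonNeg+pos (nonNeg+nonNeg (nonNeg*nonNeg (inj₁ p) (h 0F)) (nonNeg*nonNeg (inj₁ q) (h 1F))) (*-pos r k)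

  mix-sum : ∀ {α β γ} (l m n : Fin 3 → Carrier) → α + β + γ ≈ 1# →
    l 0F + l 1F + l 2F ≈ 1# → m 0F + m 1F + m 2F ≈ 1# → n 0F + n 1F + n 2F ≈ 1# →
    mix α β γ (l 0F) (m 0F) (n 0F) + mix α β γ (l 1F) (m 1F) (n 1F) + mix α β γ (l 2F) (m 2F) (n 2F) ≈ 1#
  mix-sum {α} {β} {γ} l m n s e f g = trans
    (solve 12 (λ α β γ l₁ l₂ l₃ m₁ m₂ m₃ n₁ n₂ n₃ →
      α :* l₁ :+ β :* m₁ :+ γ :* n₁ :+ (α :* l₂ :+ β :* m₂ :+ γ :* n₂) :+ (α :* l₃ :+ β :* m₃ :+ γ :* n₃)
      := α :* (l₁ :+ l₂ :+ l₃) :+ β :* (m₁ :+ m₂ :+ m₃) :+ γ :* (n₁ :+ n₂ :+ n₃)) refl α β γ (l 0F) (l 1F) (l 2F) (m 0F) (m 1F) (m 2F) (n 0F) (n 1F) (n 2F))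
    (trans (+-cong (+-cong (trans (*-congˡ e) (*-identityʳ _)) (trans (*-congˡ f) (*-identityʳ _))) (trans (*-congˡ g) (*-identityʳ _))) s)

  module _ (F : Triangle) (i : Fin 5) where
    private
      v : Fin 3 → Gauss
      v j = corner j (corners (child i))

      -- Column `j` holds the barycentric coordinates of corner `j` of the child; applying this
      -- matrix turns coordinates in the child into coordinates in the supertile.
      M : Fin 3 → Fin 3 → Carrier
      M k j = bary k (v j)

      M-nonNeg : ∀ k j → 0# ≤ M k j
      M-nonNeg k j = nonNeg*nonNeg (inj₁ 0<tenth) (fromℤ-nonNeg (weights-nonNeg i j k))

      M-pos : ∀ k → ∃[ j ] 0# < M k j
      M-pos k with weights-pos i k
      ... | j , p = j , *-pos 0<tenth (fromℤ-pos p)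

      recombine : ∀ {p α β γ} → p ≈ₚ combine α β γ (tile F (child i)) →
        p ≈ₚ combine (mix α β γ (M 0F 0F) (M 0F 1F) (M 0F 2F)) (mix α β γ (M 1F 0F) (M 1F 1F) (M 1F 2F)) (mix α β γ (M 2F 0F) (M 2F 1F) (M 2F 2F)) (tri F supertile)
      recombine e = ≈ₚ-trans e (≈ₚ-trans (⊕-cong (⊕-cong (∙-cong refl (pt-bary F (v 0F))) (∙-cong refl (pt-bary F (v 1F)))) (∙-cong refl (pt-bary F (v 2F))))
        (combine-combine _ _ _ (tri F supertile) (M 0F 0F , M 1F 0F , M 2F 0F) (M 0F 1F , M 1F 1F , M 2F 1F) (M 0F 2F , M 1F 2F , M 2F 2F)))

    child⊆supertile : ∀ {p} → p ∈△ tile F (child i) → p ∈△ tri F supertile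
    child⊆supertile (α , β , γ , p , q , r , sum , e) =
      mix α β γ (M 0F 0F) (M 0F 1F) (M 0F 2F) , mix α β γ (M 1F 0F) (M 1F 1F) (M 1F 2F) , mix α β γ (M 2F 0F) (M 2F 1F) (M 2F 2F) ,
      mix-nonNeg p q r (M-nonNeg 0F 0F) (M-nonNeg 0F 1F) (M-nonNeg 0F 2F) ,
      mix-nonNeg p q r (M-nonNeg 1F 0F) (M-nonNeg 1F 1F) (M-nonNeg 1F 2F) ,
      mix-nonNeg p q r (M-nonNeg 2F 0F) (M-nonNeg 2F 1F) (M-nonNeg 2F 2F) ,
      mix-sum (λ k → M k 0F) (λ k → M k 1F) (λ k → M k 2F) sum (bary-sum (v 0F)) (bary-sum (v 1F)) (bary-sum (v 2F)) , recombine e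

    int-child⊆supertile : ∀ {p} → p ∈int tile F (child i) → p ∈int tri F supertile
    int-child⊆supertile (α , β , γ , p , q , r , sum , e) =
      mix α β γ (M 0F 0F) (M 0F 1F) (M 0F 2F) , mix α β γ (M 1F 0F) (M 1F 1F) (M 1F 2F) , mix α β γ (M 2F 0F) (M 2F 1F) (M 2F 2F) ,
      mix-pos (M 0F) p q r (M-nonNeg 0F) (M-pos 0F) , mix-pos (M 1F) p q r (M-nonNeg 1F) (M-pos 1F) , mix-pos (M 2F) p q r (M-nonNeg 2F) (M-pos 2F) ,
      mix-sum (λ k → M k 0F) (λ k → M k 1F) (λ k → M k 2F) sum (bary-sum (v 0F)) (bary-sum (v 1F)) (bary-sum (v 2F)) , recombine e

  -- Separating lines

  -- Twice the inner product with the vector of coordinates (d , d′); the factor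
  -- makes it a polynomial in the squared lengths that define orthogonality.
  functional : Triangle → Carrier → Carrier → Point → Carrier
  functional ((p₁ , p₂) , (q₁ , q₂) , (r₁ , r₂)) d d′ (x , y) =
    x * ((1# + 1#) * (d * (q₁ - p₁) + d′ * (r₁ - p₁))) + y * ((1# + 1#) * (d * (q₂ - p₂) + d′ * (r₂ - p₂)))

  functional-cong : ∀ F d d′ {p q} → p ≈ₚ q → functional F d d′ p ≈ functional F d d′ q
  functional-cong F d d′ (e , f) = +-cong (*-congʳ e) (*-congʳ f)

  functional-at : ∀ {s F} → Orthogonal s F → ∀ d d′ x y →
    functional F d d′ (at F x y) ≈ functional F d d′ (proj₁ F) + (s + s) * (d * x + d′ * y)
  functional-at {s} {F@((p₁ , p₂) , (q₁ , q₂) , (r₁ , r₂))} o d d′ x y = begin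
    functional F d d′ (at F x y)
      ≈⟨ +-cong (coordinate p₁ q₁ r₁) (coordinate p₂ q₂ r₂) ⟩
    p₁ * w p₁ q₁ r₁ + S (sq p₁ q₁) (sq p₁ r₁) (sq q₁ r₁) + (p₂ * w p₂ q₂ r₂ + S (sq p₂ q₂) (sq p₂ r₂) (sq q₂ r₂))
      ≈⟨ solve 12 (λ d d′ x y a b c a′ b′ c′ m n →
           let S : _ → _ → _ → _
               S a b c = x :* (d :* (a :+ a) :+ d′ :* (a :+ b :- c)) :+ y :* (d :* (a :+ b :- c) :+ d′ :* (b :+ b)) in
           m :+ S a b c :+ (n :+ S a′ b′ c′) := m :+ n :+ S (a :+ a′) (b :+ b′) (c :+ c′)) refl
           d d′ x y (sq p₁ q₁) (sq p₁ r₁) (sq q₁ r₁) (sq p₂ q₂) (sq p₂ r₂) (sq q₂ r₂) (p₁ * w p₁ q₁ r₁) (p₂ * w p₂ q₂ r₂) ⟩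
    L + S (dist² P Q) (dist² P R) (dist² Q R)
      ≈⟨ +-congˡ (S-cong (PQ o) (PR o) (QR o)) ⟩
    L + S s s (s + s)
      ≈⟨ +-congˡ (solve 5 (λ d d′ x y s →
           x :* (d :* (s :+ s) :+ d′ :* (s :+ s :- (s :+ s))) :+ y :* (d :* (s :+ s :- (s :+ s)) :+ d′ :* (s :+ s))
           := (s :+ s) :* (d :* x :+ d′ :* y)) refl d d′ x y s) ⟩
    L + (s + s) * (d * x + d′ * y) ∎
    where
    P Q R : Point
    P = (p₁ , p₂)
    Q = (q₁ , q₂)
    R = (r₁ , r₂)
    L : Carrier
    L = functional F d d′ P
    sq : Carrier → Carrier → Carrier
    sq a b = (a - b) * (a - b)
    S : Carrier → Carrier → Carrier → Carrier
    S a b c = x * (d * (a + a) + d′ * (a + b - c)) + y * (d * (a + b - c) + d′ * (b + b))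
    S-cong : ∀ {a a′ b b′ c c′} → a ≈ a′ → b ≈ b′ → c ≈ c′ → S a b c ≈ S a′ b′ c′
    S-cong e f g = +-cong (*-congˡ (+-cong (*-congˡ (+-cong e e)) (*-congˡ (+-cong (+-cong e f) (-‿cong g)))))
                          (*-congˡ (+-cong (*-congˡ (+-cong (+-cong e f) (-‿cong g))) (*-congˡ (+-cong f f))))
    w : Carrier → Carrier → Carrier → Carrier
    w p q r = (1# + 1#) * (d * (q - p) + d′ * (r - p))
    coordinate : ∀ p q r → (p + x * (q - p) + y * (r - p)) * w p q r ≈ p * w p q r + S (sq p q) (sq p r) (sq q r)
    coordinate p q r = trans (*-congˡ (*-congʳ two)) (trans (solve 7 (λ d d′ x y p q r →
      let w = con (+ 2) :* (d :* (q :- p) :+ d′ :* (r :- p))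
          sq : _ → _ → _
          sq a b = (a :- b) :* (a :- b)
          a = sq p q
          b = sq p r
          c = sq q r
      in (p :+ x :* (q :- p) :+ y :* (r :- p)) :* w
         := p :* w :+ (x :* (d :* (a :+ a) :+ d′ :* (a :+ b :- c)) :+ y :* (d :* (a :+ b :- c) :+ d′ :* (b :+ b)))) refl d d′ x y p q r)
      (+-congʳ (*-congˡ (*-congʳ (sym two)))))
      where
      two : 1# + 1# ≈ fromℤ (+ 2)
      two = +-congˡ (sym (+-identityʳ 1#))

  functional-combine : ∀ F d d′ α β γ (t : Triangle) → let (a , b , c) = t in
    functional F d d′ (combine α β γ t) ≈ mix α β γ (functional F d d′ a) (functional F d d′ b) (functional F d d′ c)
  functional-combine F d d′ α β γ ((a₁ , a₂) , (b₁ , b₂) , (c₁ , c₂)) =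
    solve 11 (λ α β γ a₁ b₁ c₁ a₂ b₂ c₂ u v →
      (α :* a₁ :+ β :* b₁ :+ γ :* c₁) :* u :+ (α :* a₂ :+ β :* b₂ :+ γ :* c₂) :* v
      := α :* (a₁ :* u :+ a₂ :* v) :+ β :* (b₁ :* u :+ b₂ :* v) :+ γ :* (c₁ :* u :+ c₂ :* v)) refl α β γ a₁ b₁ c₁ a₂ b₂ c₂ _ _

  module _ {s F} (0<s : 0# < s) (o : Orthogonal s F) where

    private
      h : Gauss → Gauss → Carrier
      h d z = fromℤ (height d z)

    functional-pt : ∀ d z → functional F (fromℤ (proj₁ d)) (fromℤ (proj₂ d)) (pt F z)
                          ≈ functional F (fromℤ (proj₁ d)) (fromℤ (proj₂ d)) (proj₁ F) + (s + s) * h d z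
    functional-pt (d , d′) (x , y) = trans (functional-at o (fromℤ d) (fromℤ d′) (fromℤ x) (fromℤ y))
      (+-congˡ (*-congˡ (sym (trans (fromℤ-+ (d ℤ.* x) _) (+-cong (fromℤ-* d x) (fromℤ-* d′ y))))))

    s+s≉0 : ¬ s + s ≈ 0#
    s+s≉0 = pos⇒≉0 (pos+nonNeg 0<s (inj₁ 0<s))

    -- The functionals belonging to the two axes read off the coordinates.
    pt-injective : ∀ z z′ → pt F z ≈ₚ pt F z′ → z ≡ z′
    pt-injective z@(x , y) z′@(x′ , y′) e = ≡.cong₂ _,_
      (≡.trans (≡.sym (first x y)) (≡.trans (same (1ℤ , 0ℤ)) (first x′ y′)))
      (≡.trans (≡.sym (second x y)) (≡.trans (same (0ℤ , 1ℤ)) (second x′ y′)))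
      where
      first : ∀ x y → 1ℤ ℤ.* x ℤ.+ 0ℤ ℤ.* y ≡ x
      first = solve-∀
      second : ∀ x y → 0ℤ ℤ.* x ℤ.+ 1ℤ ℤ.* y ≡ y
      second = solve-∀
      same : ∀ d → height d z ≡ height d z′
      same d = fromℤ-injective (*-cancelˡ s+s≉0 (+-cancelˡ _ _ _ (trans (sym (functional-pt d z)) (trans (functional-cong F _ _ e) (functional-pt d z′)))))

    -- A point of both triangles lies on the separating line, so the corners off
    -- that line carry no weight.
    first-vanishes : ∀ {p α β γ} d τ σ → Separates d τ σ → FirstAbove d τ σ →
      0# ≤ α → 0# ≤ β → 0# ≤ γ → α + β + γ ≈ 1# → p ≈ₚ combine α β γ (tri F τ) → p ∈△ tri F σ → α ≈ 0#
    first-vanishes {p} {α} {β} {γ} d τ@(a , b , c) σ@(a′ , b′ , c′) (sa , sb , sc) above α≥0 β≥0 γ≥0 sum eq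
      (α′ , β′ , γ′ , α′≥0 , β′≥0 , γ′≥0 , sum′ , eq′) =
      x*y≈0⇒y≈0 (pos⇒≉0 (fromℤ-mono-< above)) (trans (*-comm _ _)
        (nonNeg+nonNeg≈0ˡ (nonNeg*nonNeg α≥0 (fromℤ-mono-≤ sa))
          (nonNeg+nonNeg (nonNeg+nonNeg (nonNeg*nonNeg β≥0 (fromℤ-mono-≤ sb)) (nonNeg*nonNeg γ≥0 (fromℤ-mono-≤ sc)))
            (mix-nonNeg α′≥0 β′≥0 γ′≥0 (fromℤ-mono-≤ below-a) (fromℤ-mono-≤ below-b) (fromℤ-mono-≤ below-c)))
          total))
      where
      m : ℤ
      m = top d σ
      M : Carrier
      M = fromℤ m
      below-a : height d a′ ℤ.≤ m
      below-a = ℤ.≤-trans (ℤ.i≤i⊔j (height d a′) (height d b′)) (ℤ.i≤i⊔j _ (height d c′))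
      below-b : height d b′ ℤ.≤ m
      below-b = ℤ.≤-trans (ℤ.i≤j⊔i (height d a′) (height d b′)) (ℤ.i≤i⊔j _ (height d c′))
      below-c : height d c′ ℤ.≤ m
      below-c = ℤ.i≤j⊔i (height d a′ ℤ.⊔ height d b′) (height d c′)
      L : Point → Carrier
      L = functional F (fromℤ (proj₁ d)) (fromℤ (proj₂ d))
      O : Carrier
      O = L (proj₁ F)
      value : ∀ {α β γ} (ρ : Corners) → α + β + γ ≈ 1# → p ≈ₚ combine α β γ (tri F ρ) →
        let (a , b , c) = ρ in L p ≈ O + (s + s) * mix α β γ (h d a) (h d b) (h d c)
      value {α} {β} {γ} (a , b , c) sum eq = begin
        L p ≈⟨ functional-cong F _ _ eq ⟩
        L (combine α β γ (tri F (a , b , c))) ≈⟨ functional-combine F _ _ α β γ (tri F (a , b , c)) ⟩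
        mix α β γ (L (pt F a)) (L (pt F b)) (L (pt F c))
          ≈⟨ +-cong (+-cong (*-congˡ (functional-pt d a)) (*-congˡ (functional-pt d b))) (*-congˡ (functional-pt d c)) ⟩
        mix α β γ (O + (s + s) * h d a) (O + (s + s) * h d b) (O + (s + s) * h d c)
          ≈⟨ solve 8 (λ α β γ o s a b c → α :* (o :+ s :* a) :+ β :* (o :+ s :* b) :+ γ :* (o :+ s :* c)
               := (α :+ β :+ γ) :* o :+ s :* (α :* a :+ β :* b :+ γ :* c)) refl α β γ O (s + s) _ _ _ ⟩
        (α + β + γ) * O + (s + s) * mix α β γ (h d a) (h d b) (h d c) ≈⟨ +-congʳ (trans (*-congʳ sum) (*-identityˡ O)) ⟩
        O + (s + s) * mix α β γ (h d a) (h d b) (h d c) ∎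
      balance : mix α β γ (h d a) (h d b) (h d c) ≈ mix α′ β′ γ′ (h d a′) (h d b′) (h d c′)
      balance = *-cancelˡ s+s≉0 (+-cancelˡ _ _ _ (trans (sym (value τ sum eq)) (value σ sum′ eq′)))
      -- Both triangles compute the same height of `p`. So the weighted excess of one over `M` and
      -- the weighted deficit of the other add up to zero; as no summand is negative, each of them
      -- vanishes.
      total : α * (h d a - M) + (β * (h d b - M) + γ * (h d c - M) + mix α′ β′ γ′ (M - h d a′) (M - h d b′) (M - h d c′)) ≈ 0#
      total = begin
        α * (h d a - M) + (β * (h d b - M) + γ * (h d c - M) + mix α′ β′ γ′ (M - h d a′) (M - h d b′) (M - h d c′))
          ≈⟨ solve 13 (λ α β γ a b c α′ β′ γ′ a′ b′ c′ m →
               α :* (a :- m) :+ (β :* (b :- m) :+ γ :* (c :- m) :+ (α′ :* (m :- a′) :+ β′ :* (m :- b′) :+ γ′ :* (m :- c′)))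
               := α :* a :+ β :* b :+ γ :* c :- (α′ :* a′ :+ β′ :* b′ :+ γ′ :* c′) :+ ((α′ :+ β′ :+ γ′) :- (α :+ β :+ γ)) :* m)
               refl α β γ _ _ _ α′ β′ γ′ _ _ _ M ⟩
        mix α β γ (h d a) (h d b) (h d c) - mix α′ β′ γ′ (h d a′) (h d b′) (h d c′) + (α′ + β′ + γ′ - (α + β + γ)) * M
          ≈⟨ +-cong (+-congʳ balance) (*-congʳ (+-cong sum′ (-‿cong sum))) ⟩
        mix α′ β′ γ′ (h d a′) (h d b′) (h d c′) - mix α′ β′ γ′ (h d a′) (h d b′) (h d c′) + (1# - 1#) * M
          ≈⟨ solve 3 (λ x o m → x :- x :+ (o :- o) :* m := con 0ℤ) refl (mix α′ β′ γ′ (h d a′) (h d b′) (h d c′)) 1# M ⟩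
        0# ∎

  rotate-combine : ∀ α β γ (t : Triangle) → let (a , b , c) = t in combine α β γ (a , b , c) ≈ₚ combine β γ α (b , c , a)
  rotate-combine α β γ ((a , a′) , (b , b′) , (c , c′)) = coordinate a b c , coordinate a′ b′ c′
    where
    coordinate : ∀ a b c → mix α β γ a b c ≈ mix β γ α b c a
    coordinate = solve 6 (λ α β γ a b c → α :* a :+ β :* b :+ γ :* c := β :* b :+ γ :* c :+ α :* a) refl α β γ

  rotate-sum : ∀ {α β γ} → α + β + γ ≈ 1# → β + γ + α ≈ 1#
  rotate-sum {α} {β} {γ} e = trans (solve 3 (λ α β γ → β :+ γ :+ α := α :+ β :+ γ) refl α β γ) e

  ∈△-rotate : ∀ {F p} τ → p ∈△ tri F τ → p ∈△ tri F (rotate τ)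
  ∈△-rotate {F} τ (α , β , γ , p , q , r , sum , e) = β , γ , α , q , r , p , rotate-sum sum , ≈ₚ-trans e (rotate-combine α β γ (tri F τ))

  ∈int-rotate : ∀ {F p} τ → p ∈int tri F τ → p ∈int tri F (rotate τ)
  ∈int-rotate {F} τ (α , β , γ , p , q , r , sum , e) = β , γ , α , q , r , p , rotate-sum sum , ≈ₚ-trans e (rotate-combine α β γ (tri F τ))

  separates-rotate : ∀ {d σ} τ → Separates d τ σ → Separates d (rotate τ) σ
  separates-rotate τ (a , b , c) = b , c , a

  infix 4 _Meets_
  -- Weaker than sharing a segment, and chosen because it is monotone: two points common to two
  -- tiles are common to their supertiles, whereas a boundary segment of a tile may be interior to
  -- its supertile.
  _Meets_ : Triangle → Triangle → Set
  t Meets u = ∃[ p ] ∃[ q ] (¬ p ≈ₚ q × p ∈△ t × q ∈△ t × p ∈△ u × q ∈△ u)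

  Meets-sym : ∀ {t u} → t Meets u → u Meets t
  Meets-sym (p , q , p≉q , a , b , c , d) = p , q , p≉q , c , d , a , b

  module _ {s F} (0<s : 0# < s) (o : Orthogonal s F) where

    -- The second and third corner lie strictly above the separating line, so the first carries all
    -- the weight.
    supported⇒≈ : ∀ {p} τ σ → Supported τ σ → p ∈△ tri F τ → p ∈△ tri F σ → p ≈ₚ pt F (proj₁ τ)
    supported⇒≈ {p} τ@(a , b , c) σ sup (α , β , γ , α≥0 , β≥0 , γ≥0 , sum , eq) p∈σ with Any.satisfied sup
    ... | d , sep , above , above′ = ≈ₚ-trans eq (collapse (pt F a) (pt F b) (pt F c))
      where
      β≈0 : β ≈ 0#
      β≈0 = first-vanishes 0<s o d (rotate τ) σ (separates-rotate {d} {σ} τ sep) above β≥0 γ≥0 α≥0 (rotate-sum sum)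
              (≈ₚ-trans eq (rotate-combine α β γ (tri F τ))) p∈σ
      γ≈0 : γ ≈ 0#
      γ≈0 = first-vanishes 0<s o d (rotate (rotate τ)) σ (separates-rotate {d} {σ} (rotate τ) (separates-rotate {d} {σ} τ sep)) above′ γ≥0 α≥0 β≥0 (rotate-sum (rotate-sum sum))
              (≈ₚ-trans eq (≈ₚ-trans (rotate-combine α β γ (tri F τ)) (rotate-combine β γ α (tri F (rotate τ))))) p∈σ
      α≈1 : α ≈ 1#
      α≈1 = trans (solve 1 (λ α → α := α :+ con 0ℤ :+ con 0ℤ) refl α) (trans (+-cong (+-congˡ (sym β≈0)) (sym γ≈0)) sum)
      collapse : ∀ a b c → combine α β γ (a , b , c) ≈ₚ a
      collapse (a , a′) (b , b′) (c , c′) = coordinate a b c , coordinate a′ b′ c′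
        where
        coordinate : ∀ a b c → mix α β γ a b c ≈ a
        coordinate a b c = trans (+-cong (+-cong (trans (*-congʳ α≈1) (*-identityˡ a)) (trans (*-congʳ β≈0) (zeroˡ b))) (trans (*-congʳ γ≈0) (zeroˡ c)))
                                 (trans (+-identityʳ _) (+-identityʳ a))

    apart⇒¬meets : ∀ τ σ → Apart τ σ → ¬ tri F τ Meets tri F σ
    apart⇒¬meets τ σ (inj₁ sup) (p , q , p≉q , p∈ , q∈ , p∈′ , q∈′) =
      p≉q (≈ₚ-trans (supported⇒≈ τ σ sup p∈ p∈′) (≈ₚ-sym (supported⇒≈ τ σ sup q∈ q∈′)))
    apart⇒¬meets τ σ (inj₂ (inj₁ sup)) (p , q , p≉q , p∈ , q∈ , p∈′ , q∈′) =
      apart⇒¬meets (rotate τ) σ (inj₁ sup) (p , q , p≉q , ∈△-rotate {F} τ p∈ , ∈△-rotate {F} τ q∈ , p∈′ , q∈′)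
    apart⇒¬meets τ σ (inj₂ (inj₂ sup)) (p , q , p≉q , p∈ , q∈ , p∈′ , q∈′) =
      apart⇒¬meets (rotate (rotate τ)) σ (inj₁ sup)
        (p , q , p≉q , ∈△-rotate {F} (rotate τ) (∈△-rotate {F} τ p∈) , ∈△-rotate {F} (rotate τ) (∈△-rotate {F} τ q∈) , p∈′ , q∈′)

    disjoint⇒∉ : ∀ τ σ → Disjoint τ σ → ∀ {p} → p ∈int tri F τ → ¬ p ∈△ tri F σ
    disjoint⇒∉ τ σ dis {p} p∈τ p∈σ with Any.satisfied dis
    ... | d , sep , above = excluded above
      where
      first : ∀ τ → Separates d τ σ → FirstAbove d τ σ → ¬ p ∈int tri F τ
      first τ sep above (α , β , γ , α>0 , β>0 , γ>0 , sum , eq) =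
        pos⇒≉0 α>0 (first-vanishes 0<s o d τ σ sep above (inj₁ α>0) (inj₁ β>0) (inj₁ γ>0) sum eq p∈σ)
      excluded : ¬ (FirstAbove d τ σ ⊎ FirstAbove d (rotate τ) σ ⊎ FirstAbove d (rotate (rotate τ)) σ)
      excluded (inj₁ above) = first τ sep above p∈τ
      excluded (inj₂ (inj₁ above)) = first (rotate τ) (separates-rotate {d} {σ} τ sep) above (∈int-rotate {F} τ p∈τ)
      excluded (inj₂ (inj₂ above)) = first (rotate (rotate τ)) (separates-rotate {d} {σ} (rotate τ) (separates-rotate {d} {σ} τ sep)) above
        (∈int-rotate {F} (rotate τ) (∈int-rotate {F} τ p∈τ))

  -- The frame of the supertiles, scaled up so that it refers to the same points.
  up : Triangle → Triangle
  up F = pt F (0ℤ , 0ℤ) , pt F (+ 2 , 1ℤ) , pt F (1ℤ , -[1+ 1 ])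

  five : Carrier
  five = fromℤ (+ 5)

  Orthogonal-up : ∀ {s F} → Orthogonal s F → Orthogonal (s * five) (up F)
  Orthogonal-up {s} o = orthogonal (dist²-pt o (0ℤ , 0ℤ) (+ 2 , 1ℤ)) (dist²-pt o (0ℤ , 0ℤ) (1ℤ , -[1+ 1 ])) (trans (dist²-pt o (+ 2 , 1ℤ) (1ℤ , -[1+ 1 ]))
    (solve 1 (λ s → s :* con (+ 10) := s :* con (+ 5) :+ s :* con (+ 5)) refl s))

  pt-up : ∀ F z → pt (up F) z ≈ₚ pt F (φ z)
  pt-up F@((p₁ , p₂) , (q₁ , q₂) , (r₁ , r₂)) (x , y) =
    ≈ₚ-trans (coordinate p₁ (q₁ - p₁) (r₁ - p₁) , coordinate p₂ (q₂ - p₂) (r₂ - p₂)) (at-cong ≈△-refl (sym re) (sym im))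
    where
    re : fromℤ (+ 2 ℤ.* x ℤ.+ y) ≈ fromℤ (+ 2) * fromℤ x + fromℤ y
    re = trans (fromℤ-+ (+ 2 ℤ.* x) y) (+-congʳ (fromℤ-* (+ 2) x))
    im : fromℤ (x ℤ.- + 2 ℤ.* y) ≈ fromℤ x - fromℤ (+ 2) * fromℤ y
    im = trans (fromℤ-minus x _) (+-congˡ (-‿cong (fromℤ-* (+ 2) y)))
    coordinate : ∀ o u v → o + fromℤ 0ℤ * u + fromℤ 0ℤ * v
      + fromℤ x * (o + fromℤ (+ 2) * u + fromℤ 1ℤ * v - (o + fromℤ 0ℤ * u + fromℤ 0ℤ * v))
      + fromℤ y * (o + fromℤ 1ℤ * u + fromℤ -[1+ 1 ] * v - (o + fromℤ 0ℤ * u + fromℤ 0ℤ * v))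
      ≈ o + (fromℤ (+ 2) * fromℤ x + fromℤ y) * u + (fromℤ x - fromℤ (+ 2) * fromℤ y) * v
    coordinate = solve 5 (λ x y o u v → o :+ con 0ℤ :* u :+ con 0ℤ :* v
      :+ x :* (o :+ con (+ 2) :* u :+ con 1ℤ :* v :- (o :+ con 0ℤ :* u :+ con 0ℤ :* v))
      :+ y :* (o :+ con 1ℤ :* u :+ con -[1+ 1 ] :* v :- (o :+ con 0ℤ :* u :+ con 0ℤ :* v))
      := o :+ (con (+ 2) :* x :+ y) :* u :+ (x :- con (+ 2) :* y) :* v) refl (fromℤ x) (fromℤ y)

  φ-corners : ∀ g → let (a , b , c) = corners g in
    (φ a , φ b , φ c) ≡ (apply (κ g) (0ℤ , 0ℤ) , apply (κ g) (+ 2 , 1ℤ) , apply (κ g) (+ 2 , -[1+ 3 ]))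
  φ-corners ((a , b) , (p , q)) = ≡.cong₂ _,_ (≡.cong₂ _,_ (e₁ a b p q) (e₂ a b p q)) (≡.cong₂ _,_
    (≡.cong₂ _,_ (e₃ a b p q) (e₄ a b p q)) (≡.cong₂ _,_ (e₅ a b p q) (e₆ a b p q)))
    where
    e₁ : ∀ a b p q → + 2 ℤ.* a ℤ.+ b ≡ + 2 ℤ.* a ℤ.+ b ℤ.+ (p ℤ.* 0ℤ ℤ.- (ℤ.- q) ℤ.* 0ℤ)
    e₁ = solve-∀
    e₂ : ∀ a b p q → a ℤ.- + 2 ℤ.* b ≡ a ℤ.- + 2 ℤ.* b ℤ.+ (p ℤ.* 0ℤ ℤ.+ (ℤ.- q) ℤ.* 0ℤ)
    e₂ = solve-∀
    e₃ : ∀ a b p q → + 2 ℤ.* (a ℤ.+ p) ℤ.+ (b ℤ.+ q) ≡ + 2 ℤ.* a ℤ.+ b ℤ.+ (p ℤ.* + 2 ℤ.- (ℤ.- q) ℤ.* 1ℤ)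
    e₃ = solve-∀
    e₄ : ∀ a b p q → a ℤ.+ p ℤ.- + 2 ℤ.* (b ℤ.+ q) ≡ a ℤ.- + 2 ℤ.* b ℤ.+ (p ℤ.* 1ℤ ℤ.+ (ℤ.- q) ℤ.* + 2)
    e₄ = solve-∀
    e₅ : ∀ a b p q → + 2 ℤ.* (a ℤ.- + 2 ℤ.* q) ℤ.+ (b ℤ.+ + 2 ℤ.* p) ≡ + 2 ℤ.* a ℤ.+ b ℤ.+ (p ℤ.* + 2 ℤ.- (ℤ.- q) ℤ.* -[1+ 3 ])
    e₅ = solve-∀
    e₆ : ∀ a b p q → a ℤ.- + 2 ℤ.* q ℤ.- + 2 ℤ.* (b ℤ.+ + 2 ℤ.* p) ≡ a ℤ.- + 2 ℤ.* b ℤ.+ (p ℤ.* -[1+ 3 ] ℤ.+ (ℤ.- q) ℤ.* + 2)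
    e₆ = solve-∀

  supertile-up : ∀ F g → tri (F ▹ κ g) supertile ≈△ tile (up F) g
  supertile-up F g = ≈△-trans (pt-▹ F (κ g) (0ℤ , 0ℤ) , pt-▹ F (κ g) (+ 2 , 1ℤ) , pt-▹ F (κ g) (+ 2 , -[1+ 3 ]))
    (≈△-trans (≈△-reflexive (≡.cong (tri F) (≡.sym (φ-corners g)))) (unscale (corners g)))
    where
    unscale : ∀ ((a , b , c) : Corners) → tri F (φ a , φ b , φ c) ≈△ tri (up F) (a , b , c)
    unscale (a , b , c) = ≈ₚ-sym (pt-up F a) , ≈ₚ-sym (pt-up F b) , ≈ₚ-sym (pt-up F c)

  -- Climbing from tiles to supertiles: disjoint interiors and contacts

  tile-child⊆ : ∀ F {n} (w : Address n) i {p} → p ∈△ tile F (pos (i ∷ w)) → p ∈△ tile (up F) (pos w)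
  tile-child⊆ F w i p∈ = ∈△-cong (supertile-up F (pos w))
    (child⊆supertile (F ▹ κ (pos w)) i (∈△-cong (≈△-sym (tile-▹ F (κ (pos w)) (child i))) p∈))

  int-tile-child⊆ : ∀ F {n} (w : Address n) i {p} → p ∈int tile F (pos (i ∷ w)) → p ∈int tile (up F) (pos w)
  int-tile-child⊆ F w i p∈ = ∈int-cong (supertile-up F (pos w))
    (int-child⊆supertile (F ▹ κ (pos w)) i (∈int-cong (≈△-sym (tile-▹ F (κ (pos w)) (child i))) p∈))

  Meets-cong : ∀ {t t′ u u′} → t ≈△ t′ → u ≈△ u′ → t Meets u → t′ Meets u′
  Meets-cong e f (p , q , p≉q , a , b , c , d) = p , q , p≉q , ∈△-cong e a , ∈△-cong e b , ∈△-cong f c , ∈△-cong f d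

  _≟ₐ_ : ∀ {n} (w v : Address n) → Dec (w ≡ v)
  _≟ₐ_ = Vec.≡-dec Fin._≟_

  0<s*five : ∀ {s} → 0# < s → 0# < s * five
  0<s*five p = *-pos p (0<fromℤ-suc 4)

  -- The point climbs through the supertiles until these coincide; there it would lie in two
  -- distinct siblings. The squared length `s` is arbitrary because it grows by the factor 5 at each
  -- level. The second tile is taken closed, as `covers` does not provide interior points.
  interiors-disjoint : ∀ {s F n} → 0# < s → Orthogonal s F → (w v : Address n) → w ≢ v →
    ∀ {p} → p ∈int tile F (pos w) → ¬ p ∈△ tile F (pos v)
  interiors-disjoint 0<s o [] [] w≢v _ _ = w≢v ≡.refl
  interiors-disjoint {F = F} 0<s o (i ∷ w) (j ∷ v) w≢v p∈w p∈v with w ≟ₐ v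
  ... | no w≢v′ = interiors-disjoint (0<s*five 0<s) (Orthogonal-up o) w v w≢v′ (int-tile-child⊆ F w i p∈w) (tile-child⊆ F v j p∈v)
  ... | yes ≡.refl = disjoint⇒∉ 0<s (Orthogonal-▹ (κ (pos w)) o (Unit-κ (pos w) (Unit-pos w))) (corners (child i)) (corners (child j))
    (siblings-disjoint i j (λ { ≡.refl → w≢v ≡.refl }))
    (∈int-cong (≈△-sym (tile-▹ F (κ (pos w)) (child i))) p∈w) (∈△-cong (≈△-sym (tile-▹ F (κ (pos w)) (child j))) p∈v)

  apartOrContact⇒contact : ∀ {s F n} → 0# < s → Orthogonal s F → (w : Address n) (i : Fin 5) (v : Address (suc n)) (k : Placement) →
    ApartOrContact i k → pos v ≡ κ (pos w) ⋄ k → tile F (pos (i ∷ w)) Meets tile F (pos v) → Contact (i ∷ w) v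
  apartOrContact⇒contact {F = F} 0<s o w i v k (inj₂ contact) e _ with find contact
  ... | h , h∈ , k≡ = h , h∈ , ≡.trans e (≡.trans (≡.cong (κ (pos w) ⋄_) k≡) (≡.sym (⋄-assoc (κ (pos w)) (child i) h)))
  apartOrContact⇒contact {s} {F} 0<s o w i v k (inj₁ apart) e meets = contradiction meets′ (¬meets′ apart)
    where
    g : Placement
    g = κ (pos w)
    o′ : Orthogonal s (F ▹ g)
    o′ = Orthogonal-▹ g o (Unit-κ (pos w) (Unit-pos w))
    meets′ : tile (F ▹ g) (child i) Meets tile (F ▹ g) k
    meets′ = Meets-cong (≈△-sym (tile-▹ F g (child i))) (≈△-trans (≈△-reflexive (≡.cong (tile F) e)) (≈△-sym (tile-▹ F g k))) meets
    ¬meets′ : Apart (corners (child i)) (corners k) ⊎ Apart (corners k) (corners (child i)) → ¬ tile (F ▹ g) (child i) Meets tile (F ▹ g) k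
    ¬meets′ (inj₁ a) m = apart⇒¬meets 0<s o′ (corners (child i)) (corners k) a m
    ¬meets′ (inj₂ a) m = apart⇒¬meets 0<s o′ (corners k) (corners (child i)) a (Meets-sym m)

  contact⇒cousins : ∀ {n} (w v : Address n) → Contact w v → ∃[ h ] ((∀ i j → ApartOrContact i (κ h ⋄ child j)) × pos v ≡ pos w ⋄ h)
  contact⇒cousins (k ∷ _) v (h , h∈ , e) = h , All.lookup (cousins-contact k) h∈ , e

  meets-up : ∀ F {n} (w v : Address n) i j → tile F (pos (i ∷ w)) Meets tile F (pos (j ∷ v)) → tile (up F) (pos w) Meets tile (up F) (pos v)
  meets-up F w v i j (p , q , p≉q , a , b , c , d) = p , q , p≉q , tile-child⊆ F w i a , tile-child⊆ F w i b , tile-child⊆ F v j c , tile-child⊆ F v j d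

  meets⇒contact : ∀ {s F n} → 0# < s → Orthogonal s F → (w v : Address n) → w ≢ v →
    tile F (pos w) Meets tile F (pos v) → Contact w v
  meets⇒contact 0<s o [] [] w≢v _ = w≢v ≡.refl
  meets⇒contact {F = F} 0<s o (i ∷ w) (j ∷ v) w≢v meets with w ≟ₐ v
  ... | yes ≡.refl = apartOrContact⇒contact 0<s o w i (j ∷ v) (child j) (siblings-contact i j (λ { ≡.refl → w≢v ≡.refl })) ≡.refl meets
  ... | no w≢v′ = let h , check , e = contact⇒cousins w v (meets⇒contact (0<s*five 0<s) (Orthogonal-up o) w v w≢v′ (meets-up F w v i j meets)) in
    apartOrContact⇒contact 0<s o w i (j ∷ v) (κ h ⋄ child j) (check i j)
      (≡.trans (≡.cong (λ k → κ k ⋄ child j) e) (≡.trans (≡.cong (_⋄ child j) (κ-⋄ (pos w) h)) (⋄-assoc (κ (pos w)) (κ h) (child j)))) meets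

  -- Isometries

  dist²≈0⇒≈ : ∀ {p q} → dist² p q ≈ 0# → p ≈ₚ q
  dist²≈0⇒≈ {x , y} {x′ , y′} e =
    x-y≈0⇒x≈y (x*x≈0⇒x≈0 (nonNeg+nonNeg≈0ˡ (0≤x*x (x - x′)) (0≤x*x (y - y′)) e)) ,
    x-y≈0⇒x≈y (x*x≈0⇒x≈0 (nonNeg+nonNeg≈0ˡ (0≤x*x (y - y′)) (0≤x*x (x - x′)) (trans (+-comm _ _) e)))

  ≈⇒dist²≈0 : ∀ {p q} → p ≈ₚ q → dist² p q ≈ 0#
  ≈⇒dist²≈0 {p} {x , y} e = trans (dist²-cong e ≈ₚ-refl)
    (solve 2 (λ x y → (x :- x) :* (x :- x) :+ (y :- y) :* (y :- y) := con 0ℤ) refl x y)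

  isometry-cong : ∀ {f p q} → IsIsometry f → p ≈ₚ q → f p ≈ₚ f q
  isometry-cong f-iso e = dist²≈0⇒≈ (trans (f-iso _ _) (≈⇒dist²≈0 e))

  image-cong : ∀ {f t u} → IsIsometry f → t ≈△ u → image f t ≈△ image f u
  image-cong f-iso (a , b , c) = isometry-cong f-iso a , isometry-cong f-iso b , isometry-cong f-iso c

  Orthogonal-image : ∀ {f s F} → IsIsometry f → Orthogonal s F → Orthogonal s (image f F)
  Orthogonal-image f-iso o = orthogonal (trans (f-iso _ _) (PQ o)) (trans (f-iso _ _) (PR o)) (trans (f-iso _ _) (QR o))

  -- q ⊖ q′ is perpendicular to both axes of F.
  trilateration : ∀ {s} {F : Triangle} {q q′} → 0# < s → Orthogonal s F → let (P , Q , R) = F in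
    dist² q P ≈ dist² q′ P → dist² q Q ≈ dist² q′ Q → dist² q R ≈ dist² q′ R → q ≈ₚ q′
  trilateration {s} {(p₁ , p₂) , (q₁ , q₂) , (r₁ , r₂)} {x , y} {x′ , y′} s>0 o eP eQ eR =
    -- Cramer's rule: the products of `q ⊖ q′` with both axes vanish, and the determinant `D` does
    -- not.
    x-y≈0⇒x≈y (x*y≈0⇒y≈0 D≉0 (trans (solve 6 (λ a b u₁ u₂ v₁ v₂ →
        con (+ 2) :* (u₁ :* v₂ :- u₂ :* v₁) :* a := v₂ :* (con (+ 2) :* (a :* u₁ :+ b :* u₂)) :- u₂ :* (con (+ 2) :* (a :* v₁ :+ b :* v₂)))
        refl (x - x′) (y - y′) u₁ u₂ v₁ v₂) (vanish v₂ u₂ wu wv))) ,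
    x-y≈0⇒x≈y (x*y≈0⇒y≈0 D≉0 (trans (solve 6 (λ a b u₁ u₂ v₁ v₂ →
        con (+ 2) :* (u₁ :* v₂ :- u₂ :* v₁) :* b := u₁ :* (con (+ 2) :* (a :* v₁ :+ b :* v₂)) :- v₁ :* (con (+ 2) :* (a :* u₁ :+ b :* u₂)))
        refl (x - x′) (y - y′) u₁ u₂ v₁ v₂) (vanish u₁ v₁ wv wu)))
    where
    P Q R : Point
    P = p₁ , p₂
    Q = q₁ , q₂
    R = r₁ , r₂
    u₁ = q₁ - p₁
    u₂ = q₂ - p₂
    v₁ = r₁ - p₁
    v₂ = r₂ - p₂
    two : Carrier
    two = fromℤ (+ 2)
    vanish : ∀ a b {m n} → m ≈ 0# → n ≈ 0# → a * m - b * n ≈ 0#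
    vanish a b e f = trans (+-cong (*-congˡ e) (-‿cong (*-congˡ f))) (solve 2 (λ a b → a :* con 0ℤ :- b :* con 0ℤ := con 0ℤ) refl a b)
    perpendicular : ∀ {z₁ z₂} → dist² (x , y) (z₁ , z₂) ≈ dist² (x′ , y′) (z₁ , z₂) →
      two * ((x - x′) * (z₁ - p₁) + (y - y′) * (z₂ - p₂)) ≈ 0#
    perpendicular {z₁} {z₂} e = trans (solve 8 (λ x x′ y y′ z₁ z₂ p₁ p₂ →
      let d : _ → _ → _ → _ → _
          d a b a′ b′ = (a :- a′) :* (a :- a′) :+ (b :- b′) :* (b :- b′) in
      con (+ 2) :* ((x :- x′) :* (z₁ :- p₁) :+ (y :- y′) :* (z₂ :- p₂))
      := con 1ℤ :* (d x y p₁ p₂ :- d x′ y′ p₁ p₂) :- con 1ℤ :* (d x y z₁ z₂ :- d x′ y′ z₁ z₂)) refl x x′ y y′ z₁ z₂ p₁ p₂)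
      (vanish (fromℤ 1ℤ) (fromℤ 1ℤ) (trans (+-congʳ eP) (-‿inverseʳ _)) (trans (+-congʳ e) (-‿inverseʳ _)))
    wu = perpendicular eQ
    wv = perpendicular eR
    D : Carrier
    D = two * (u₁ * v₂ - u₂ * v₁)
    -- Lagrange's identity: the square of twice the determinant is 4 |u|² |v|² minus the square of
    -- twice the inner product of u and v, so the three distances determine it.
    D² : D * D ≈ (s + s) * (s + s)
    D² = begin
      D * D ≈⟨ solve 6 (λ p₁ p₂ q₁ q₂ r₁ r₂ →
          let d : _ → _ → _ → _ → _
              d a b a′ b′ = (a :- a′) :* (a :- a′) :+ (b :- b′) :* (b :- b′)
              D = con (+ 2) :* ((q₁ :- p₁) :* (r₂ :- p₂) :- (q₂ :- p₂) :* (r₁ :- p₁))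
              pq = d p₁ p₂ q₁ q₂
              pr = d p₁ p₂ r₁ r₂
              qr = d q₁ q₂ r₁ r₂ in
          D :* D := con (+ 4) :* (pq :* pr) :- (pq :+ pr :- qr) :* (pq :+ pr :- qr)) refl p₁ p₂ q₁ q₂ r₁ r₂ ⟩
      fromℤ (+ 4) * (dist² P Q * dist² P R) - (dist² P Q + dist² P R - dist² Q R) * (dist² P Q + dist² P R - dist² Q R)
        ≈⟨ +-cong (*-congˡ (*-cong (PQ o) (PR o))) (-‿cong (*-cong zero-product zero-product)) ⟩
      fromℤ (+ 4) * (s * s) - (s + s - (s + s)) * (s + s - (s + s))
        ≈⟨ solve 1 (λ s → con (+ 4) :* (s :* s) :- (s :+ s :- (s :+ s)) :* (s :+ s :- (s :+ s)) := (s :+ s) :* (s :+ s)) refl s ⟩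
      (s + s) * (s + s) ∎
      where
      zero-product : dist² P Q + dist² P R - dist² Q R ≈ s + s - (s + s)
      zero-product = +-cong (+-cong (PQ o) (PR o)) (-‿cong (QR o))
    D≉0 : ¬ D ≈ 0#
    D≉0 e = s+s≉0 s>0 o (x*x≈0⇒x≈0 (trans (sym D²) (trans (*-congʳ e) (zeroˡ D))))

  at-P : ∀ F → at F 0# 0# ≈ₚ proj₁ F
  at-P ((p , p′) , (q , q′) , (r , r′)) = coordinate p (q - p) (r - p) , coordinate p′ (q′ - p′) (r′ - p′)
    where
    coordinate : ∀ o u v → o + 0# * u + 0# * v ≈ o
    coordinate = solve 3 (λ o u v → o :+ con 0ℤ :* u :+ con 0ℤ :* v := o) refl

  at-Q : ∀ F → at F 1# 0# ≈ₚ proj₁ (proj₂ F)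
  at-Q ((p , p′) , (q , q′) , (r , r′)) = coordinate p q r , coordinate p′ q′ r′
    where
    coordinate : ∀ p q r → p + 1# * (q - p) + 0# * (r - p) ≈ q
    coordinate p q r = trans (+-congʳ (+-congˡ (*-identityˡ _))) (solve 3 (λ p q r → p :+ (q :- p) :+ con 0ℤ :* (r :- p) := q) refl p q r)

  at-R : ∀ F → at F 0# 1# ≈ₚ proj₂ (proj₂ F)
  at-R ((p , p′) , (q , q′) , (r , r′)) = coordinate p q r , coordinate p′ q′ r′
    where
    coordinate : ∀ p q r → p + 0# * (q - p) + 1# * (r - p) ≈ r
    coordinate p q r = trans (+-congˡ (*-identityˡ _)) (solve 3 (λ p q r → p :+ con 0ℤ :* (q :- p) :+ (r :- p) := r) refl p q r)

  -- An isometry is not assumed to be affine. Both sides have the same distances from the three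
  -- points of `image f F`, and these distances determine a point.
  isometry-at : ∀ {f s F} → IsIsometry f → 0# < s → Orthogonal s F → ∀ x y → f (at F x y) ≈ₚ at (image f F) x y
  isometry-at {f} {s} {F} f-iso s>0 o x y =
    trilateration s>0 o′ (same (at-P F) (at-P (image f F))) (same (at-Q F) (at-Q (image f F))) (same (at-R F) (at-R (image f F)))
    where
    o′ = Orthogonal-image f-iso o
    same : ∀ {a b c} → at F a b ≈ₚ c → at (image f F) a b ≈ₚ f c → dist² (f (at F x y)) (f c) ≈ dist² (at (image f F) x y) (f c)
    same {a} {b} {c} e e′ = begin
      dist² (f (at F x y)) (f c)              ≈⟨ f-iso _ _ ⟩
      dist² (at F x y) c                      ≈⟨ dist²-cong ≈ₚ-refl e ⟨
      dist² (at F x y) (at F a b)             ≈⟨ dist²-at o x y a b ⟩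
      s * ((x - a) * (x - a) + (y - b) * (y - b)) ≈⟨ dist²-at o′ x y a b ⟨
      dist² (at (image f F) x y) (at (image f F) a b) ≈⟨ dist²-cong ≈ₚ-refl e′ ⟩
      dist² (at (image f F) x y) (f c)        ∎

  image-tri : ∀ {f s F} τ → IsIsometry f → 0# < s → Orthogonal s F → image f (tri F τ) ≈△ tri (image f F) τ
  image-tri {f} {s} {F} (a , b , c) f-iso s>0 o = vertex a , vertex b , vertex c
    where
    vertex : ∀ z → f (pt F z) ≈ₚ pt (image f F) z
    vertex (x , y) = isometry-at f-iso s>0 o (fromℤ x) (fromℤ y)

  half : Carrier
  half = fromℤ (+ 2) ⁻¹

  two-half : fromℤ (+ 2) * half ≈ 1#
  two-half = ⁻¹-inverseʳ _ (fromℤ-suc≉0 1)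

  -- The long leg is halved so that both axes have the length of the short leg; this recovers the
  -- frame that places the tile.
  frameOf : Triangle → Triangle
  frameOf (a , b , c) = a , b , a ⊕ half ∙ (c ⊖ a)

  frameOf-cong : ∀ {t u} → t ≈△ u → frameOf t ≈△ frameOf u
  frameOf-cong (a , b , c) = a , b , ⊕-cong a (∙-cong refl (⊖-cong c a))

  frameOf-tile : ∀ F g → frameOf (tile F g) ≈△ F ▹ g
  frameOf-tile F@((p₁ , p₂) , (q₁ , q₂) , (r₁ , r₂)) ((a , b) , (p , q)) =
    ≈ₚ-refl , ≈ₚ-refl , coordinate p₁ (q₁ - p₁) (r₁ - p₁) , coordinate p₂ (q₂ - p₂) (r₂ - p₂)
    where
    coordinate : ∀ o u v → o + fromℤ a * u + fromℤ b * v
      + half * (o + fromℤ (a ℤ.- + 2 ℤ.* q) * u + fromℤ (b ℤ.+ + 2 ℤ.* p) * v - (o + fromℤ a * u + fromℤ b * v))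
      ≈ o + fromℤ (a ℤ.- q) * u + fromℤ (b ℤ.+ p) * v
    coordinate o u v = begin
      o + A * u + B * v + half * (o + fromℤ (a ℤ.- + 2 ℤ.* q) * u + fromℤ (b ℤ.+ + 2 ℤ.* p) * v - (o + A * u + B * v))
        ≈⟨ +-congˡ (*-congˡ (+-congʳ (+-cong (+-congˡ (*-congʳ (trans (fromℤ-minus a _) (+-congˡ (-‿cong (fromℤ-* (+ 2) q))))))
                                              (*-congʳ (trans (fromℤ-+ b _) (+-congˡ (fromℤ-* (+ 2) p))))))) ⟩
      o + A * u + B * v + half * (o + (A - fromℤ (+ 2) * Q) * u + (B + fromℤ (+ 2) * P) * v - (o + A * u + B * v))
        ≈⟨ solve 8 (λ h o u v A B P Q → o :+ A :* u :+ B :* v :+ h :* (o :+ (A :- con (+ 2) :* Q) :* u :+ (B :+ con (+ 2) :* P) :* v :- (o :+ A :* u :+ B :* v))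
              := o :+ A :* u :+ B :* v :+ con (+ 2) :* h :* (P :* v :- Q :* u)) refl half o u v A B P Q ⟩
      o + A * u + B * v + fromℤ (+ 2) * half * (P * v - Q * u) ≈⟨ +-congˡ (trans (*-congʳ two-half) (*-identityˡ _)) ⟩
      o + A * u + B * v + (P * v - Q * u)
        ≈⟨ solve 7 (λ o u v A B P Q → o :+ A :* u :+ B :* v :+ (P :* v :- Q :* u) := o :+ (A :- Q) :* u :+ (B :+ P) :* v) refl o u v A B P Q ⟩
      o + (A - Q) * u + (B + P) * v ≈⟨ +-cong (+-congˡ (*-congʳ (fromℤ-minus a q))) (*-congʳ (fromℤ-+ b p)) ⟨
      o + fromℤ (a ℤ.- q) * u + fromℤ (b ℤ.+ p) * v ∎
      where
      A = fromℤ a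
      B = fromℤ b
      P = fromℤ p
      Q = fromℤ q

  Orthogonal-cong : ∀ {s F G} → F ≈△ G → Orthogonal s F → Orthogonal s G
  Orthogonal-cong (a , b , c) o = orthogonal (trans (dist²-cong (≈ₚ-sym a) (≈ₚ-sym b)) (PQ o))
    (trans (dist²-cong (≈ₚ-sym a) (≈ₚ-sym c)) (PR o)) (trans (dist²-cong (≈ₚ-sym b) (≈ₚ-sym c)) (QR o))

  corners-injective : ∀ g h → proj₁ (corners g) ≡ proj₁ (corners h) → proj₁ (proj₂ (corners g)) ≡ proj₁ (proj₂ (corners h)) → g ≡ h
  corners-injective ((a , b) , (p , q)) (_ , (p′ , q′)) ≡.refl e =
    ≡.cong ((a , b) ,_) (≡.cong₂ _,_ (ℤ-+-cancelˡ a p p′ (≡.cong proj₁ e)) (ℤ-+-cancelˡ b q q′ (≡.cong proj₂ e)))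

  tile-injective : ∀ {s F} → 0# < s → Orthogonal s F → ∀ g h → tile F g ≈△ tile F h → g ≡ h
  tile-injective s>0 o g h (e , f , _) = corners-injective g h
    (pt-injective s>0 o (proj₁ (corners g)) (proj₁ (corners h)) e)
    (pt-injective s>0 o (proj₁ (proj₂ (corners g))) (proj₁ (proj₂ (corners h))) f)

  -- Eliminates `F`, which varies with the patch, in favour of a frame that depends only on the tile
  -- `t`.
  tile-relative : ∀ F g h {t u} → Unit g → t ≈△ tile F g → u ≈△ tile F h → u ≈△ tile (frameOf t) (inv g ⋄ h)
  tile-relative F g h u t≈ u≈ = ≈△-trans u≈ (≈△-trans (≈△-reflexive (≡.cong (tile F) (≡.sym (⋄-cancel-inv g h u))))
    (≈△-trans (≈△-sym (tile-▹ F g (inv g ⋄ h))) (tri-cong (corners (inv g ⋄ h)) (≈△-sym (≈△-trans (frameOf-cong t≈) (frameOf-tile F g))))))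

  Orthogonal-frameOf : ∀ {s} F g {t} → Orthogonal s F → Unit g → t ≈△ tile F g → Orthogonal s (frameOf t)
  Orthogonal-frameOf F g o u t≈ = Orthogonal-cong (≈△-sym (≈△-trans (frameOf-cong t≈) (frameOf-tile F g))) (Orthogonal-▹ g o u)

  -- The supremum of {0} ∪ {1 | A} is positive exactly when ¬ ¬ A, and its sign is
  -- decidable.
  wlem : ∀ (A : Set) → Dec (¬ A)
  wlem A = decide (complete S (0# , inj₁ refl) (1# , below-1))
    where
    S : Pred Carrier 0ℓ
    S x = x ≈ 0# ⊎ (A × x ≈ 1#)
    below-1 : UpperBound S 1#
    below-1 (inj₁ e)       = inj₁ (<-respˡ (sym e) 0<1)
    below-1 (inj₂ (_ , e)) = inj₂ e
    decide : ∃[ s ] (UpperBound S s × (∀ {b} → UpperBound S b → s ≤ b)) → Dec (¬ A)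
    decide (s , upper , least) with compare 0# s
    ... | tri< 0<s _ _ = no λ ¬a → ≤⇒≯ (least (λ { (inj₁ e) → inj₂ e ; (inj₂ (a , _)) → contradiction a ¬a })) 0<s
    ... | tri≈ _ 0≈s _ = yes λ a → ≤⇒≯ (upper (inj₂ (a , refl))) (<-respˡ 0≈s 0<1)
    ... | tri> _ _ s<0 = yes λ a → ≤⇒≯ (upper (inj₁ refl)) s<0

  -- Segments

  endpointˡ : ∀ p q → p ∈[ p , q ]
  endpointˡ (x , y) (x′ , y′) = 0# , inj₂ refl , inj₁ 0<1 , coordinate x x′ , coordinate y y′
    where
    coordinate : ∀ a b → a ≈ (1# - 0#) * a + 0# * b
    coordinate a b = trans (sym (*-identityˡ a)) (solve 3 (λ o a b → o :* a := (o :- con 0ℤ) :* a :+ con 0ℤ :* b) refl 1# a b)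

  endpointʳ : ∀ p q → q ∈[ p , q ]
  endpointʳ (x , y) (x′ , y′) = 1# , inj₁ 0<1 , inj₂ refl , coordinate x x′ , coordinate y y′
    where
    coordinate : ∀ a b → b ≈ (1# - 1#) * a + 1# * b
    coordinate a b = trans (sym (*-identityˡ b)) (solve 3 (λ o a b → o :* b := (o :- o) :* a :+ o :* b) refl 1# a b)

  ∈∂⇒∈△ : ∀ {x t} → x ∈∂ t → x ∈△ t
  ∈∂⇒∈△ {t = (a₁ , a₂) , (b₁ , b₂) , (c₁ , c₂)} (inj₁ (l , 0≤l , l≤1 , e , e′)) =
    1# - l , l , 0# , ≤⇒0≤- l≤1 , 0≤l , inj₂ refl , solve 2 (λ o l → o :- l :+ l :+ con 0ℤ := o) refl 1# l ,
    trans e (coordinate a₁ b₁ c₁) , trans e′ (coordinate a₂ b₂ c₂)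
    where
    coordinate : ∀ a b c → (1# - l) * a + l * b ≈ (1# - l) * a + l * b + 0# * c
    coordinate a b c = solve 5 (λ o l a b c → (o :- l) :* a :+ l :* b := (o :- l) :* a :+ l :* b :+ con 0ℤ :* c) refl 1# l a b c
  ∈∂⇒∈△ {t = (a₁ , a₂) , (b₁ , b₂) , (c₁ , c₂)} (inj₂ (inj₁ (l , 0≤l , l≤1 , e , e′))) =
    0# , 1# - l , l , inj₂ refl , ≤⇒0≤- l≤1 , 0≤l , solve 2 (λ o l → con 0ℤ :+ (o :- l) :+ l := o) refl 1# l ,
    trans e (coordinate a₁ b₁ c₁) , trans e′ (coordinate a₂ b₂ c₂)
    where
    coordinate : ∀ a b c → (1# - l) * b + l * c ≈ 0# * a + (1# - l) * b + l * c
    coordinate a b c = solve 5 (λ o l a b c → (o :- l) :* b :+ l :* c := con 0ℤ :* a :+ (o :- l) :* b :+ l :* c) refl 1# l a b c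
  ∈∂⇒∈△ {t = (a₁ , a₂) , (b₁ , b₂) , (c₁ , c₂)} (inj₂ (inj₂ (l , 0≤l , l≤1 , e , e′))) =
    l , 0# , 1# - l , 0≤l , inj₂ refl , ≤⇒0≤- l≤1 , solve 2 (λ o l → l :+ con 0ℤ :+ (o :- l) := o) refl 1# l ,
    trans e (coordinate a₁ b₁ c₁) , trans e′ (coordinate a₂ b₂ c₂)
    where
    coordinate : ∀ a b c → (1# - l) * c + l * a ≈ l * a + 0# * b + (1# - l) * c
    coordinate a b c = solve 5 (λ o l a b c → (o :- l) :* c :+ l :* a := l :* a :+ con 0ℤ :* b :+ (o :- l) :* c) refl 1# l a b c

  shareSegment⇒meets : ∀ {t u} → ShareSegment t u → t Meets u
  shareSegment⇒meets (p , q , p≉q , on-both) = p , q , p≉q ,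
    ∈∂⇒∈△ (proj₁ p∈) , ∈∂⇒∈△ (proj₁ q∈) , ∈∂⇒∈△ (proj₂ p∈) , ∈∂⇒∈△ (proj₂ q∈)
    where
    p∈ = on-both p (endpointˡ p q)
    q∈ = on-both q (endpointʳ p q)

  ≤-from-0≤- : ∀ {x y} → 0# ≤ y - x → x ≤ y
  ≤-from-0≤- {x} {y} (inj₁ p) = inj₁ (<-respˡ (+-identityˡ x) (<-respʳ (solve 2 (λ x y → y :- x :+ x := y) refl x y) (+-monoˡ-< x p)))
  ≤-from-0≤- (inj₂ e) = inj₂ (sym (x-y≈0⇒x≈y (sym e)))

  segment-convex : ∀ {a b p q x} → p ∈[ a , b ] → q ∈[ a , b ] → x ∈[ p , q ] → x ∈[ a , b ]
  segment-convex {a₁ , a₂} {b₁ , b₂} (m , 0≤m , m≤1 , p₁≈ , p₂≈) (n , 0≤n , n≤1 , q₁≈ , q₂≈) (l , 0≤l , l≤1 , x₁≈ , x₂≈) =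
    (1# - l) * m + l * n ,
    nonNeg+nonNeg (nonNeg*nonNeg (≤⇒0≤- l≤1) 0≤m) (nonNeg*nonNeg 0≤l 0≤n) ,
    ≤-from-0≤- (≤-respʳ complement (nonNeg+nonNeg (nonNeg*nonNeg (≤⇒0≤- l≤1) (≤⇒0≤- m≤1)) (nonNeg*nonNeg 0≤l (≤⇒0≤- n≤1)))) ,
    trans x₁≈ (trans (+-cong (*-congˡ p₁≈) (*-congˡ q₁≈)) (coordinate a₁ b₁)) ,
    trans x₂≈ (trans (+-cong (*-congˡ p₂≈) (*-congˡ q₂≈)) (coordinate a₂ b₂))
    where
    1l≈l : (1# - l) + l ≈ 1#
    1l≈l = solve 2 (λ o l → o :- l :+ l := o) refl 1# l
    complement : (1# - l) * (1# - m) + l * (1# - n) ≈ 1# - ((1# - l) * m + l * n)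
    complement = trans (solve 4 (λ o l m n → (o :- l) :* (o :- m) :+ l :* (o :- n) := ((o :- l) :+ l) :* o :- ((o :- l) :* m :+ l :* n)) refl 1# l m n)
      (+-congʳ (trans (*-identityʳ _) 1l≈l))
    coordinate : ∀ a b → (1# - l) * ((1# - m) * a + m * b) + l * ((1# - n) * a + n * b) ≈ (1# - ((1# - l) * m + l * n)) * a + ((1# - l) * m + l * n) * b
    coordinate a b = trans (solve 6 (λ o l m n a b →
        (o :- l) :* ((o :- m) :* a :+ m :* b) :+ l :* ((o :- n) :* a :+ n :* b)
        := (((o :- l) :+ l) :* o :- ((o :- l) :* m :+ l :* n)) :* a :+ ((o :- l) :* m :+ l :* n) :* b) refl 1# l m n a b)
      (+-congʳ (*-congʳ (+-congʳ (trans (*-identityʳ _) 1l≈l))))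

  segment-cong : ∀ {x a a′ b b′} → a ≈ₚ a′ → b ≈ₚ b′ → x ∈[ a , b ] → x ∈[ a′ , b′ ]
  segment-cong e f (l , 0≤l , l≤1 , x≈) = l , 0≤l , l≤1 , ≈ₚ-trans x≈ (⊕-cong (∙-cong refl e) (∙-cong refl f))

  ∂-cong : ∀ {x t u} → t ≈△ u → x ∈∂ t → x ∈∂ u
  ∂-cong (e , f , g) (inj₁ h)        = inj₁ (segment-cong e f h)
  ∂-cong (e , f , g) (inj₂ (inj₁ h)) = inj₂ (inj₁ (segment-cong f g h))
  ∂-cong (e , f , g) (inj₂ (inj₂ h)) = inj₂ (inj₂ (segment-cong g e h))

  ShareSegment-cong : ∀ {t t′ u u′} → t ≈△ t′ → u ≈△ u′ → ShareSegment t u → ShareSegment t′ u′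
  ShareSegment-cong e f (p , q , p≉q , on-both) = p , q , p≉q , λ x x∈ → ∂-cong e (proj₁ (on-both x x∈)) , ∂-cong f (proj₂ (on-both x x∈))

  ShareSegment-sym : ∀ {t u} → ShareSegment t u → ShareSegment u t
  ShareSegment-sym (p , q , p≉q , on-both) = p , q , p≉q , λ x x∈ → proj₂ (on-both x x∈) , proj₁ (on-both x x∈)

  0<half : 0# < half
  0<half = 0<x⇒0<x⁻¹ (0<fromℤ-suc 1)

  1-half≈half : 1# - half ≈ half
  1-half≈half = trans (+-congʳ (sym two-half)) (solve 1 (λ h → con (+ 2) :* h :- h := h) refl half)

  midpoint : ∀ F a b z → a ⊞ b ≡ z ⊞ z → pt F z ∈[ pt F a , pt F b ]
  midpoint F@((p₁ , p₂) , (q₁ , q₂) , (r₁ , r₂)) (a , a′) (b , b′) (z , z′) e =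
    half , inj₁ 0<half , ≤-from-0≤- (≤-respʳ (sym 1-half≈half) (inj₁ 0<half)) ,
    coordinate p₁ (q₁ - p₁) (r₁ - p₁) , coordinate p₂ (q₂ - p₂) (r₂ - p₂)
    where
    sum : ∀ {a b z} → a ℤ.+ b ≡ z ℤ.+ z → fromℤ a + fromℤ b ≈ fromℤ z + fromℤ z
    sum {a} {b} {z} e = trans (sym (fromℤ-+ a b)) (trans (reflexive (≡.cong fromℤ e)) (fromℤ-+ z z))
    coordinate : ∀ o u v → o + fromℤ z * u + fromℤ z′ * v ≈ (1# - half) * (o + fromℤ a * u + fromℤ a′ * v) + half * (o + fromℤ b * u + fromℤ b′ * v)
    coordinate o u v = begin
      o + fromℤ z * u + fromℤ z′ * v ≈⟨ *-identityˡ _ ⟨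
      1# * (o + fromℤ z * u + fromℤ z′ * v) ≈⟨ *-congʳ two-half ⟨
      fromℤ (+ 2) * half * (o + fromℤ z * u + fromℤ z′ * v)
        ≈⟨ solve 6 (λ h z z′ o u v → con (+ 2) :* h :* (o :+ z :* u :+ z′ :* v) := h :* (con (+ 2) :* o :+ (z :+ z) :* u :+ (z′ :+ z′) :* v)) refl half (fromℤ z) (fromℤ z′) o u v ⟩
      half * (fromℤ (+ 2) * o + (fromℤ z + fromℤ z) * u + (fromℤ z′ + fromℤ z′) * v)
        ≈⟨ *-congˡ (+-cong (+-congˡ (*-congʳ (sum {a} {b} {z} (≡.cong proj₁ e)))) (*-congʳ (sum {a′} {b′} {z′} (≡.cong proj₂ e)))) ⟨
      half * (fromℤ (+ 2) * o + (fromℤ a + fromℤ b) * u + (fromℤ a′ + fromℤ b′) * v)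
        ≈⟨ solve 8 (λ h a a′ b b′ o u v → h :* (con (+ 2) :* o :+ (a :+ b) :* u :+ (a′ :+ b′) :* v)
             := h :* (o :+ a :* u :+ a′ :* v) :+ h :* (o :+ b :* u :+ b′ :* v)) refl half (fromℤ a) (fromℤ a′) (fromℤ b) (fromℤ b′) o u v ⟩
      half * (o + fromℤ a * u + fromℤ a′ * v) + half * (o + fromℤ b * u + fromℤ b′ * v) ≈⟨ +-congʳ (*-congʳ 1-half≈half) ⟨
      (1# - half) * (o + fromℤ a * u + fromℤ a′ * v) + half * (o + fromℤ b * u + fromℤ b′ * v) ∎

  -- Three pairwise adjacent tiles of ω²(K).
  trio : Fin 3 → Address 2
  trio 0F = 0F ∷ 2F ∷ []
  trio 1F = 2F ∷ 2F ∷ []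
  trio 2F = 4F ∷ 3F ∷ []

  module _ {F} (o : Orthogonal 1# F) where

    private
      along : ∀ {t u} z z′ → z ≢ z′ → (∀ {x} → x ∈[ pt F z , pt F z′ ] → x ∈∂ t) → (∀ {x} → x ∈[ pt F z , pt F z′ ] → x ∈∂ u) → ShareSegment t u
      along z z′ z≢z′ on-t on-u = pt F z , pt F z′ , (λ e → z≢z′ (pt-injective 0<1 o z z′ e)) , λ x x∈ → on-t x∈ , on-u x∈

      endˡ : ∀ a b → pt F a ∈[ pt F a , pt F b ]
      endˡ a b = endpointˡ (pt F a) (pt F b)

      endʳ : ∀ a b → pt F b ∈[ pt F a , pt F b ]
      endʳ a b = endpointʳ (pt F a) (pt F b)

      -- The three tiles surround the point `a₀`: tiles 0 and 1 have their right angles there, and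
      -- it is the midpoint of the long leg of tile 2. Each shared segment starts at `a₀` and has
      -- length 1.
      a₀ a₁ c₀ b₁ a₂ c₁ c₂ : Gauss
      a₀ = + 2 , + 2
      a₁ = + 2 , + 1
      c₀ = + 4 , + 2
      b₁ = + 3 , + 2
      c₁ = + 2 , + 4
      a₂ = + 2 , + 3
      c₂ = + 2 , + 1

    trio-01 : ShareSegment (tile F (pos (trio 0F))) (tile F (pos (trio 1F)))
    trio-01 = along a₀ b₁ (λ ())
      (λ x∈ → inj₂ (inj₂ (segment-convex (endʳ c₀ a₀) (midpoint F c₀ a₀ b₁ ≡.refl) x∈)))
      (λ x∈ → inj₁ x∈)

    trio-02 : ShareSegment (tile F (pos (trio 0F))) (tile F (pos (trio 2F)))
    trio-02 = along a₀ c₂ (λ ())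
      (λ x∈ → inj₁ x∈)
      (λ x∈ → inj₂ (inj₂ (segment-convex (midpoint F c₂ a₂ a₀ ≡.refl) (endˡ c₂ a₂) x∈)))

    trio-12 : ShareSegment (tile F (pos (trio 1F))) (tile F (pos (trio 2F)))
    trio-12 = along a₀ a₂ (λ ())
      (λ x∈ → inj₂ (inj₂ (segment-convex (endʳ c₁ a₀) (midpoint F c₁ a₀ a₂ ≡.refl) x∈)))
      (λ x∈ → inj₂ (inj₂ (segment-convex (midpoint F c₂ a₂ a₀ ≡.refl) (endʳ c₂ a₂) x∈)))

    trio-share : ∀ k l → k ≢ l → ShareSegment (tile F (pos (trio k))) (tile F (pos (trio l)))
    trio-share 0F 1F _ = trio-01
    trio-share 0F 2F _ = trio-02
    trio-share 1F 2F _ = trio-12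
    trio-share 1F 0F _ = ShareSegment-sym {tile F (pos (trio 0F))} {tile F (pos (trio 1F))} trio-01
    trio-share 2F 0F _ = ShareSegment-sym {tile F (pos (trio 0F))} {tile F (pos (trio 2F))} trio-02
    trio-share 2F 1F _ = ShareSegment-sym {tile F (pos (trio 1F))} {tile F (pos (trio 2F))} trio-12
    trio-share 0F 0F k≢k = contradiction ≡.refl k≢k
    trio-share 1F 1F k≢k = contradiction ≡.refl k≢k
    trio-share 2F 2F k≢k = contradiction ≡.refl k≢k

  third : Carrier
  third = fromℤ (+ 3) ⁻¹

  0<third : 0# < third
  0<third = 0<x⇒0<x⁻¹ (0<fromℤ-suc 2)

  centroid : Triangle → Point
  centroid t = combine third third third t

  centroid∈int : ∀ t → centroid t ∈int t
  centroid∈int t = third , third , third , 0<third , 0<third , 0<third ,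
    trans (solve 1 (λ t → t :+ t :+ t := con (+ 3) :* t) refl third) (⁻¹-inverseʳ _ (fromℤ-suc≉0 2)) , ≈ₚ-refl

  trio-injective : ∀ k l → trio k ≡ trio l → k ≡ l
  trio-injective 0F 0F _ = ≡.refl
  trio-injective 1F 1F _ = ≡.refl
  trio-injective 2F 2F _ = ≡.refl
  trio-injective 0F 1F ()
  trio-injective 0F 2F ()
  trio-injective 1F 0F ()
  trio-injective 1F 2F ()
  trio-injective 2F 0F ()
  trio-injective 2F 1F ()

  -- `κ (κ (pos w))` is common to all tiles of a level-2 supertile, so adjacency within the trio can
  -- be shown in the one frame that it defines.
  pos-++ : ∀ {n} (v : Address 2) (w : Address n) → pos (v ++ w) ≡ κ (κ (pos w)) ⋄ pos v
  pos-++ (i ∷ j ∷ []) w = ≡.trans (≡.cong (_⋄ child i) (κ-⋄ (κ (pos w)) (child j)))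
    (≡.trans (⋄-assoc (κ (κ (pos w))) (κ (child j)) (child i)) (≡.cong (λ g → κ (κ (pos w)) ⋄ (κ g ⋄ child i)) (≡.sym (one-⋄ (child j)))))

  module Tiling (√5 : Carrier) (√5-spec : IsSqrt5 √5) {T : Pred Triangle 0ℓ}
                (T-tiling : Substitution.IsRationalPinwheelTiling √5 T) where
    open Substitution √5
    open IsRationalPinwheelTiling T-tiling

    -- The substitution

    fifth : Carrier
    fifth = fromℤ (+ 5) ⁻¹

    five-fifth : fromℤ (+ 5) * fifth ≈ 1#
    five-fifth = ⁻¹-inverseʳ _ (fromℤ-suc≉0 4)

    two-tenth : fromℤ (+ 2) * tenth ≈ fifth
    two-tenth = *-cancelˡ (fromℤ-suc≉0 4) (trans (trans (solve 1 (λ t → con (+ 5) :* (con (+ 2) :* t) := con (+ 10) :* t) refl tenth) ten-tenth) (sym five-fifth))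

    -- The homothety of ratio 1/√5 that takes P to √5 P.
    shrink : Point → Point → Point
    shrink P p = √5 ∙ P ⊕ (√5 * fifth) ∙ (p ⊖ P)

    shrink-cong : ∀ P {p q} → p ≈ₚ q → shrink P p ≈ₚ shrink P q
    shrink-cong P e = ⊕-cong ≈ₚ-refl (∙-cong refl (⊖-cong e ≈ₚ-refl))

    -- The new frame has to satisfy √5 · `pt F z` = `pt (expand F) (φ z)`. Since `φ` applied twice
    -- is multiplication by 5, it is inverted by applying it again and dividing by 5: `up` applies
    -- it, and `shrink` combines the division by 5 with the expansion by √5.
    expand : Triangle → Triangle
    expand F = image (shrink (proj₁ F)) (up F)

    dist²-shrink : ∀ P p q → dist² (shrink P p) (shrink P q) ≈ √5 * fifth * (√5 * fifth) * dist² p q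
    dist²-shrink (o , o′) (x , y) (x′ , y′) = solve 8 (λ s c o o′ x y x′ y′ →
      let S : _ → _ → _
          S o x = s :* o :+ s :* c :* (x :- o) in
      (S o x :- S o x′) :* (S o x :- S o x′) :+ (S o′ y :- S o′ y′) :* (S o′ y :- S o′ y′)
      := s :* c :* (s :* c) :* ((x :- x′) :* (x :- x′) :+ (y :- y′) :* (y :- y′))) refl √5 fifth o o′ x y x′ y′

    Orthogonal-expand : ∀ {s F} → Orthogonal s F → Orthogonal s (expand F)
    Orthogonal-expand {s} {F} o = orthogonal
      (trans (dist²-shrink P A B) (trans (*-congˡ (PQ o′)) cancel))
      (trans (dist²-shrink P A C) (trans (*-congˡ (PR o′)) cancel))
      (trans (dist²-shrink P B C) (trans (*-congˡ (QR o′)) (trans (distribˡ _ _ _) (+-cong cancel cancel))))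
      where
      P A B C : Point
      P = proj₁ F
      A = proj₁ (up F)
      B = proj₁ (proj₂ (up F))
      C = proj₂ (proj₂ (up F))
      o′ : Orthogonal (s * five) (up F)
      o′ = Orthogonal-up o
      cancel : √5 * fifth * (√5 * fifth) * (s * five) ≈ s
      cancel = begin
        √5 * fifth * (√5 * fifth) * (s * five) ≈⟨ solve 4 (λ r c s f → r :* c :* (r :* c) :* (s :* f) := r :* r :* c :* (f :* c) :* s) refl √5 fifth s five ⟩
        √5 * √5 * fifth * (five * fifth) * s   ≈⟨ *-congʳ (*-cong (*-congʳ (proj₂ √5-spec)) refl) ⟩
        five * fifth * (five * fifth) * s      ≈⟨ *-congʳ (*-cong five-fifth five-fifth) ⟩
        1# * 1# * s                            ≈⟨ trans (*-congʳ (*-identityˡ 1#)) (*-identityˡ s) ⟩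
        s                                      ∎

    pt-expand : ∀ F z → pt (expand F) z ≈ₚ shrink (proj₁ F) (pt F (φ z))
    pt-expand F@((p₁ , p₂) , _) z@(x , y) = ≈ₚ-trans (affine (up F) (fromℤ x) (fromℤ y)) (shrink-cong (proj₁ F) {pt (up F) z} {pt F (φ z)} (pt-up F z))
      where
      affine : ∀ G x y → at (image (shrink (proj₁ F)) G) x y ≈ₚ shrink (proj₁ F) (at G x y)
      affine ((p , p′) , (q , q′) , (r , r′)) x y = coordinate p₁ p q r , coordinate p₂ p′ q′ r′
        where
        coordinate : ∀ o p q r → √5 * o + √5 * fifth * (p - o) + x * (√5 * o + √5 * fifth * (q - o) - (√5 * o + √5 * fifth * (p - o)))
                                                             + y * (√5 * o + √5 * fifth * (r - o) - (√5 * o + √5 * fifth * (p - o)))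
                   ≈ √5 * o + √5 * fifth * (p + x * (q - p) + y * (r - p) - o)
        coordinate = solve 8 (λ s c x y o p q r →
          s :* o :+ s :* c :* (p :- o) :+ x :* (s :* o :+ s :* c :* (q :- o) :- (s :* o :+ s :* c :* (p :- o)))
                                       :+ y :* (s :* o :+ s :* c :* (r :- o) :- (s :* o :+ s :* c :* (p :- o)))
          := s :* o :+ s :* c :* (p :+ x :* (q :- p) :+ y :* (r :- p) :- o)) refl √5 fifth x y

    place-cong : ∀ {t u} x y → t ≈△ u → place t x y ≈ₚ place u x y
    place-cong x y (a , b , c) = ⊕-cong (⊕-cong a (∙-cong refl (⊖-cong b a))) (∙-cong refl (⊖-cong c a))

    φ-apply-κ : ∀ a b p q x y → φ (apply (κ ((a , b) , (p , q))) (x , ℤ.- y)) ≡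
      ( + 5 ℤ.* a ℤ.+ (p ℤ.* (+ 2 ℤ.* x ℤ.- y) ℤ.- q ℤ.* (x ℤ.+ + 2 ℤ.* y))
      , + 5 ℤ.* b ℤ.+ (p ℤ.* (x ℤ.+ + 2 ℤ.* y) ℤ.+ q ℤ.* (+ 2 ℤ.* x ℤ.- y)))
    φ-apply-κ a b p q x y = ≡.cong₂ _,_ (re a b p q x y) (im a b p q x y)
      where
      re : ∀ a b p q x y → + 2 ℤ.* (+ 2 ℤ.* a ℤ.+ b ℤ.+ (p ℤ.* x ℤ.- (ℤ.- q) ℤ.* (ℤ.- y))) ℤ.+ (a ℤ.- + 2 ℤ.* b ℤ.+ (p ℤ.* (ℤ.- y) ℤ.+ (ℤ.- q) ℤ.* x))
         ≡ + 5 ℤ.* a ℤ.+ (p ℤ.* (+ 2 ℤ.* x ℤ.- y) ℤ.- q ℤ.* (x ℤ.+ + 2 ℤ.* y))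
      re = solve-∀
      im : ∀ a b p q x y → + 2 ℤ.* a ℤ.+ b ℤ.+ (p ℤ.* x ℤ.- (ℤ.- q) ℤ.* (ℤ.- y)) ℤ.- + 2 ℤ.* (a ℤ.- + 2 ℤ.* b ℤ.+ (p ℤ.* (ℤ.- y) ℤ.+ (ℤ.- q) ℤ.* x))
         ≡ + 5 ℤ.* b ℤ.+ (p ℤ.* (x ℤ.+ + 2 ℤ.* y) ℤ.+ q ℤ.* (+ 2 ℤ.* x ℤ.- y))
      im = solve-∀

    place-tile : ∀ F g x y → place (image (√5 ∙_) (tile F g)) x y ≈ₚ pt (expand F) (apply (κ g) (x , ℤ.- y))
    place-tile F@((p₁ , p₂) , (q₁ , q₂) , (r₁ , r₂)) g@((a , b) , (p , q)) x y = ≈ₚ-sym (≈ₚ-trans (pt-expand F (apply (κ g) (x , ℤ.- y)))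
      (≈ₚ-trans (≈ₚ-reflexive (≡.cong (λ z → shrink (proj₁ F) (pt F z)) (φ-apply-κ a b p q x y)))
        (coordinate p₁ (q₁ - p₁) (r₁ - p₁) , coordinate p₂ (q₂ - p₂) (r₂ - p₂))))
      where
      -- `m` and `n` are the coordinates of `φ (x , - y)`. In `place` the second is divided by 10
      -- rather than 5 because it multiplies the long leg, which is twice the unit of the lattice.
      m = + 2 ℤ.* x ℤ.- y
      n = x ℤ.+ + 2 ℤ.* y
      A = fromℤ a
      B = fromℤ b
      P = fromℤ p
      Q = fromℤ q
      M = fromℤ m
      N = fromℤ n
      re : fromℤ (+ 5 ℤ.* a ℤ.+ (p ℤ.* m ℤ.- q ℤ.* n)) ≈ fromℤ (+ 5) * A + (P * M - Q * N)
      re = trans (fromℤ-+ (+ 5 ℤ.* a) _) (+-cong (fromℤ-* (+ 5) a) (trans (fromℤ-minus (p ℤ.* m) _) (+-cong (fromℤ-* p m) (-‿cong (fromℤ-* q n)))))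
      im : fromℤ (+ 5 ℤ.* b ℤ.+ (p ℤ.* n ℤ.+ q ℤ.* m)) ≈ fromℤ (+ 5) * B + (P * N + Q * M)
      im = trans (fromℤ-+ (+ 5 ℤ.* b) _) (+-cong (fromℤ-* (+ 5) b) (trans (fromℤ-+ (p ℤ.* n) _) (+-cong (fromℤ-* p n) (fromℤ-* q m))))
      coordinate : ∀ o u v →
        √5 * o + √5 * fifth * (o + fromℤ (+ 5 ℤ.* a ℤ.+ (p ℤ.* m ℤ.- q ℤ.* n)) * u + fromℤ (+ 5 ℤ.* b ℤ.+ (p ℤ.* n ℤ.+ q ℤ.* m)) * v - o)
        ≈ √5 * (o + A * u + B * v)
          + M * fifth * (√5 * (o + fromℤ (a ℤ.+ p) * u + fromℤ (b ℤ.+ q) * v) - √5 * (o + A * u + B * v))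
          + N * tenth * (√5 * (o + fromℤ (a ℤ.- + 2 ℤ.* q) * u + fromℤ (b ℤ.+ + 2 ℤ.* p) * v) - √5 * (o + A * u + B * v))
      coordinate o u v = begin
        √5 * o + √5 * fifth * (o + fromℤ (+ 5 ℤ.* a ℤ.+ (p ℤ.* m ℤ.- q ℤ.* n)) * u + fromℤ (+ 5 ℤ.* b ℤ.+ (p ℤ.* n ℤ.+ q ℤ.* m)) * v - o)
          ≈⟨ +-congˡ (*-congˡ (+-congʳ (+-cong (+-congˡ (*-congʳ re)) (*-congʳ im)))) ⟩
        √5 * o + √5 * fifth * (o + (fromℤ (+ 5) * A + (P * M - Q * N)) * u + (fromℤ (+ 5) * B + (P * N + Q * M)) * v - o)
          ≈⟨ solve 11 (λ s c o u v A B P Q M N →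
               s :* o :+ s :* c :* (o :+ (con (+ 5) :* A :+ (P :* M :- Q :* N)) :* u :+ (con (+ 5) :* B :+ (P :* N :+ Q :* M)) :* v :- o)
               := s :* o :+ con (+ 5) :* c :* (s :* (A :* u :+ B :* v)) :+ M :* c :* (s :* (P :* u :+ Q :* v)) :+ c :* (N :* (s :* (P :* v :- Q :* u))))
               refl √5 fifth o u v A B P Q M N ⟩
        √5 * o + fromℤ (+ 5) * fifth * (√5 * (A * u + B * v)) + M * fifth * (√5 * (P * u + Q * v)) + fifth * (N * (√5 * (P * v - Q * u)))
          ≈⟨ +-cong (+-congʳ (+-congˡ (trans (*-congʳ five-fifth) (*-identityˡ _)))) (*-congʳ (sym two-tenth)) ⟩
        √5 * o + √5 * (A * u + B * v) + M * fifth * (√5 * (P * u + Q * v)) + fromℤ (+ 2) * tenth * (N * (√5 * (P * v - Q * u)))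
          ≈⟨ solve 12 (λ s c d o u v A B P Q M N →
               s :* o :+ s :* (A :* u :+ B :* v) :+ M :* c :* (s :* (P :* u :+ Q :* v)) :+ con (+ 2) :* d :* (N :* (s :* (P :* v :- Q :* u)))
               := s :* (o :+ A :* u :+ B :* v)
                  :+ M :* c :* (s :* (o :+ (A :+ P) :* u :+ (B :+ Q) :* v) :- s :* (o :+ A :* u :+ B :* v))
                  :+ N :* d :* (s :* (o :+ (A :- con (+ 2) :* Q) :* u :+ (B :+ con (+ 2) :* P) :* v) :- s :* (o :+ A :* u :+ B :* v)))
               refl √5 fifth tenth o u v A B P Q M N ⟩
        √5 * (o + A * u + B * v)
          + M * fifth * (√5 * (o + (A + P) * u + (B + Q) * v) - √5 * (o + A * u + B * v))
          + N * tenth * (√5 * (o + (A - fromℤ (+ 2) * Q) * u + (B + fromℤ (+ 2) * P) * v) - √5 * (o + A * u + B * v))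
          ≈⟨ +-cong (+-congˡ (*-congˡ (+-congʳ (*-congˡ (+-cong (+-congˡ (*-congʳ (fromℤ-+ a p))) (*-congʳ (fromℤ-+ b q)))))))
                    (*-congˡ (+-congʳ (*-congˡ (+-cong (+-congˡ (*-congʳ (trans (fromℤ-minus a _) (+-congˡ (-‿cong (fromℤ-* (+ 2) q))))))
                                                         (*-congʳ (trans (fromℤ-+ b _) (+-congˡ (fromℤ-* (+ 2) p)))))))) ⟨
        √5 * (o + A * u + B * v)
          + M * fifth * (√5 * (o + fromℤ (a ℤ.+ p) * u + fromℤ (b ℤ.+ q) * v) - √5 * (o + A * u + B * v))
          + N * tenth * (√5 * (o + fromℤ (a ℤ.- + 2 ℤ.* q) * u + fromℤ (b ℤ.+ + 2 ℤ.* p) * v) - √5 * (o + A * u + B * v)) ∎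

    -- The tiles of ω^n(K) as placements in one frame

    frame : ℕ → Triangle
    frame zero    = (0# , 0#) , (1# , 0#) , (0# , 1#)
    frame (suc n) = expand (frame n)

    Orthonormal : Triangle → Set
    Orthonormal = Orthogonal 1#

    Orthonormal-frame : ∀ n → Orthonormal (frame n)
    Orthonormal-frame (suc n) = Orthogonal-expand (Orthonormal-frame n)
    Orthonormal-frame zero = orthogonal
      (trans (solve 1 (λ o → (z :- o) :* (z :- o) :+ (z :- z) :* (z :- z) := o :* o) refl 1#) (*-identityˡ 1#))
      (trans (solve 1 (λ o → (z :- z) :* (z :- z) :+ (z :- o) :* (z :- o) := o :* o) refl 1#) (*-identityˡ 1#))
      (trans (solve 1 (λ o → (o :- z) :* (o :- z) :+ (z :- o) :* (z :- o) := o :* o :+ o :* o) refl 1#) (+-cong (*-identityˡ 1#) (*-identityˡ 1#)))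
      where
      z : ∀ {n} → Polynomial n
      z = con 0ℤ

    K-tile : K ≈△ tile (frame 0) one
    K-tile = (origin-coordinate 1# 0# , origin-coordinate 0# 1#) , (axis-coordinate 1# 0# , axis-coordinate 0# 1#) ,
      (solve 1 (λ a → con 0ℤ := con 0ℤ :+ con 0ℤ :* (a :- con 0ℤ) :+ con (+ 2) :* (con 0ℤ :- con 0ℤ)) refl 1# ,
       trans (sym (*-identityʳ _)) (solve 1 (λ o → con (+ 2) :* o := con 0ℤ :+ con 0ℤ :* (con 0ℤ :- con 0ℤ) :+ con (+ 2) :* (o :- con 0ℤ)) refl 1#))
      where
      origin-coordinate : ∀ a b → 0# ≈ 0# + fromℤ 0ℤ * (a - 0#) + fromℤ 0ℤ * (b - 0#)
      origin-coordinate = solve 2 (λ a b → con 0ℤ := con 0ℤ :+ con 0ℤ :* (a :- con 0ℤ) :+ con 0ℤ :* (b :- con 0ℤ)) refl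
      axis-coordinate : ∀ a b → a ≈ 0# + fromℤ 1ℤ * (a - 0#) + fromℤ 0ℤ * (b - 0#)
      axis-coordinate = solve 2 (λ a b → a := con 0ℤ :+ con 1ℤ :* (a :- con 0ℤ) :+ con 0ℤ :* (b :- con 0ℤ)) refl

    dissect-tile : ∀ {t n} (w : Address n) → t ≈△ tile (frame n) (pos w) →
      All (λ u → ∃[ v ] u ≈△ tile (frame (suc n)) (pos {suc n} v)) (dissect (image (√5 ∙_) t))
    dissect-tile {t} {n} w t≈ =
      (0F ∷ w , placed 0F (+ 2) 0ℤ (+ 2) -1ℤ 0ℤ 0ℤ ≡.refl) ∷ (1F ∷ w , placed 1F 1ℤ 0ℤ 0ℤ 0ℤ 1ℤ (+ 2) ≡.refl) ∷ (2F ∷ w , placed 2F (+ 2) 0ℤ 1ℤ 0ℤ (+ 2) (+ 2) ≡.refl) ∷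
      (3F ∷ w , placed 3F 1ℤ (+ 2) (+ 2) (+ 2) 1ℤ 0ℤ ≡.refl) ∷ (4F ∷ w , placed 4F (+ 2) (+ 2) 1ℤ (+ 2) (+ 2) (+ 4) ≡.refl) ∷ []
      where
      scaled : image (√5 ∙_) t ≈△ image (√5 ∙_) (tile (frame n) (pos w))
      scaled = ∙-cong refl (proj₁ t≈) , ∙-cong refl (proj₁ (proj₂ t≈)) , ∙-cong refl (proj₂ (proj₂ t≈))
      vertex : ∀ x y → place (image (√5 ∙_) t) x y ≈ₚ pt (frame (suc n)) (apply (κ (pos w)) (x , ℤ.- y))
      vertex x y = ≈ₚ-trans (place-cong x y scaled) (place-tile (frame n) (pos w) x y)
      placed : ∀ i x y x′ y′ x″ y″ → corners (child i) ≡ ((x , ℤ.- y) , (x′ , ℤ.- y′) , (x″ , ℤ.- y″)) →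
        (place (image (√5 ∙_) t) x y , place (image (√5 ∙_) t) x′ y′ , place (image (√5 ∙_) t) x″ y″) ≈△ tile (frame (suc n)) (pos (i ∷ w))
      placed i x y x′ y′ x″ y″ e = ≈△-trans (vertex x y , vertex x′ y′ , vertex x″ y″)
        (≈△-reflexive (≡.cong (tri (frame (suc n))) (≡.sym (≡.trans (corners-⋄ (κ (pos w)) (child i))
          (≡.cong (λ (a , b , c) → apply (κ (pos w)) a , apply (κ (pos w)) b , apply (κ (pos w)) c) e)))))

    ω^-tile : ∀ n → All (λ t → ∃[ w ] t ≈△ tile (frame n) (pos {n} w)) (ω^ n [K])
    ω^-tile zero    = ([] , K-tile) ∷ []
    ω^-tile (suc n) = All.concat⁺ (All.map⁺ (All.map (λ (w , e) → dissect-tile w e) (ω^-tile n)))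

    image-placed : ∀ {f n} → IsIsometry f → ∀ {t} → Any (t ≈△_) (map (image f) ω^ n [K]) → ∃[ w ] t ≈△ tile (image f (frame n)) (pos {n} w)
    image-placed {f} {n} f-iso {t} t∈ with All.lookupAny (ω^-tile n) (Any.map⁻ t∈)
    ... | (w , e) , t≈ = w , ≈△-trans t≈ (≈△-trans (image-cong f-iso e) (image-tri (corners (pos w)) f-iso 0<1 (Orthonormal-frame n)))

    -- A patch of level n is part of one of level n + 2, so every patch may be
    -- assumed to consist of supertiles of level 2.
    extend : ∀ {n} → Address n → Address (2 ℕ.+ n)
    extend []      = 0F ∷ 0F ∷ []
    extend (i ∷ w) = i ∷ extend w

    κ^ : ℕ → Placement
    κ^ zero    = pos (0F ∷ 0F ∷ [])
    κ^ (suc n) = κ (κ^ n)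

    Unit-κ^ : ∀ n → Unit (κ^ n)
    Unit-κ^ zero    = Unit-pos (0F ∷ 0F ∷ [])
    Unit-κ^ (suc n) = Unit-κ (κ^ n) (Unit-κ^ n)

    pos-extend : ∀ {n} (w : Address n) → pos (extend w) ≡ κ^ n ⋄ pos w
    pos-extend []              = ≡.sym (⋄-one (κ^ 0))
    pos-extend {suc n} (i ∷ w) = ≡.trans (≡.cong (λ g → κ g ⋄ child i) (pos-extend w))
      (≡.trans (≡.cong (_⋄ child i) (κ-⋄ (κ^ n) (pos w))) (⋄-assoc (κ^ (suc n)) (κ (pos w)) (child i)))

    tile-extend : ∀ F {n} (w : Address n) → tile F (pos w) ≈△ tile (F ▹ inv (κ^ n)) (pos (extend w))
    tile-extend F {n} w = ≈△-sym (≈△-trans (tile-▹ F (inv (κ^ n)) (pos (extend w)))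
      (≈△-reflexive (≡.cong (tile F) (≡.trans (≡.cong (inv (κ^ n) ⋄_) (pos-extend w)) (inv-⋄-cancel (κ^ n) (pos w) (Unit-κ^ n))))))

    Placed : ∀ n → Triangle → Triangle → Set
    Placed n F t = ∃[ w ] t ≈△ tile F (pos {2 ℕ.+ n} w)

    -- The isometry of the patch is absorbed into an orthonormal frame of either orientation, so
    -- that only addresses and placements remain.
    patch : ∀ ts → All T ts → ∃[ n ] ∃[ F ] (Orthonormal F × All (Placed n F) ts)
    patch ts ts⊆T with patches ts ts⊆T
    ... | n , f , f-iso , ts⊆ = n , image f (frame n) ▹ inv (κ^ n) ,
      Orthogonal-▹ (inv (κ^ n)) (Orthogonal-image f-iso (Orthonormal-frame n)) (Unit-inv (κ^ n) (Unit-κ^ n)) ,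
      All.tabulateₛ triangleSetoid (λ t∈ → let w , e = image-placed {f} {n} f-iso (ts⊆ t∈) in extend w , ≈△-trans e (tile-extend (image f (frame n)) w))

    -- Three colours suffice

    -- Any tile of T would do as the point of reference; `covers` supplies one.
    base : Triangle
    base = proj₁ (covers (0# , 0#))

    base∈T : T base
    base∈T = proj₁ (proj₂ (covers (0# , 0#)))

    -- Orthonormality of the frame of `base` is read off from a patch; it is carried along because
    -- uniqueness of the placement rests on it.
    Relative : Triangle → Placement → Set
    Relative t r = Orthonormal (frameOf base) × t ≈△ tile (frameOf base) r

    -- Makes the colour independent of the patch from which the relative placement was obtained and
    -- of the proof that the tile belongs to T.
    Relative-unique : ∀ {t u} r r′ → Relative t r → Relative u r′ → t ≈△ u → r ≡ r′
    Relative-unique r r′ (o , e) (_ , e′) t≈u = tile-injective 0<1 o r r′ (≈△-trans (≈△-sym e) (≈△-trans t≈u e′))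

    relative-in-patch : ∀ F g h {t} → Orthonormal F → Unit g → base ≈△ tile F g → t ≈△ tile F h → Relative t (inv g ⋄ h)
    relative-in-patch F g h o u b≈ t≈ = Orthogonal-frameOf F g o u b≈ , tile-relative F g h u b≈ t≈

    abstract
      relative : ∀ {t} → T t → ∃[ r ] Relative t r
      relative {t} t∈T = from-patch (patch (base ∷ t ∷ []) (base∈T ∷ t∈T ∷ []))
        where
        from-patch : ∃[ n ] ∃[ F ] (Orthonormal F × All (Placed n F) (base ∷ t ∷ [])) → ∃[ r ] Relative t r
        from-patch (n , F , o , (w , b≈) ∷ (v , t≈) ∷ []) =
          inv (pos w) ⋄ pos v , relative-in-patch F (pos w) (pos v) o (Unit-pos w) b≈ t≈

    -- s is a guess for origin (pos w) modulo 10, where w is the address of base.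
    colour : Residue → ∀ t → T t → Fin 3
    colour s t t∈T = col (act (proj₁ (relative t∈T)) (lift s))

    colour-cong : ∀ s {t u} (t∈T : T t) (u∈T : T u) → t ≈△ u → colour s t t∈T ≡ colour s u u∈T
    colour-cong s t∈T u∈T e = ≡.cong (λ r → col (act r (lift s)))
      (Relative-unique (proj₁ (relative t∈T)) (proj₁ (relative u∈T)) (proj₂ (relative t∈T)) (proj₂ (relative u∈T)) e)

    -- `act` carries the origin seen from `base` to the origin seen from `t`. So with the residue
    -- that `base` has in this patch, the colours are those to which `col-contact` applies.
    colour-in-patch : ∀ {n F} (w v : Address n) {t} (t∈T : T t) → Orthonormal F → base ≈△ tile F (pos w) → t ≈△ tile F (pos v) →
      colour (residue (origin (pos w))) t t∈T ≡ col (origin (pos v))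
    colour-in-patch {F = F} w v {t} t∈T o b≈ t≈ = ≡.trans
      (≡.cong (λ r → col (act r (lift s))) (Relative-unique (proj₁ (relative t∈T)) r (proj₂ (relative t∈T)) (relative-in-patch F (pos w) (pos v) o (Unit-pos w) b≈ t≈) ≈△-refl))
      (≡.trans (≡.sym (col-cong (act r (origin (pos w))) (act r (lift s)) (act-cong r (origin (pos w)) (lift s) (≡ᵍ-residue (origin (pos w))))))
        (≡.cong col (≡.trans (≡.sym (origin-⋄ (pos w) r (Unit-pos w))) (≡.cong origin (⋄-cancel-inv (pos w) (pos v) (Unit-pos w))))))
      where
      s : Residue
      s = residue (origin (pos w))
      r : Placement
      r = inv (pos w) ⋄ pos v

    Proper : Residue → Set
    Proper s = ∀ {t u} (t∈T : T t) (u∈T : T u) → ¬ t ≈△ u → ShareSegment t u → colour s t t∈T ≢ colour s u u∈T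

    -- A counterexample to properness in positive form: its two tiles can be listed and put into a
    -- patch, which a mere negation of `Proper s` does not allow.
    record Clash (s : Residue) : Set where
      constructor clash
      field
        {left right} : Triangle
        left∈T       : T left
        right∈T      : T right
        distinct     : ¬ left ≈△ right
        share        : ShareSegment left right
        same         : colour s left left∈T ≡ colour s right right∈T

    open Clash

    proper-in-patch : ∀ {n F} (w : Address n) (c : Clash (residue (origin (pos w)))) → Orthonormal F → base ≈△ tile F (pos w) →
      ∃[ v ] left c ≈△ tile F (pos {n} v) → ∃[ v ] right c ≈△ tile F (pos {n} v) → ⊥
    proper-in-patch {F = F} w c o b≈ (v , t≈) (v′ , u≈) = col-contact v v′
      (meets⇒contact 0<1 o v v′ v≢v′ (Meets-cong t≈ u≈ (shareSegment⇒meets (share c))))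
      (≡.trans (≡.sym (colour-in-patch w v (left∈T c) o b≈ t≈)) (≡.trans (same c) (colour-in-patch w v′ (right∈T c) o b≈ u≈)))
      where
      v≢v′ : v ≢ v′
      v≢v′ ≡.refl = distinct c (≈△-trans t≈ (≈△-sym u≈))

    clashing : ∀ {l} → All Clash l → List Triangle
    clashing []       = []
    clashing (c ∷ cs) = left c ∷ right c ∷ clashing cs

    clashing⊆T : ∀ {l} (cs : All Clash l) → All T (clashing cs)
    clashing⊆T []       = []
    clashing⊆T (c ∷ cs) = left∈T c ∷ right∈T c ∷ clashing⊆T cs

    clashing-lookup : ∀ {l s} {P : Pred Triangle 0ℓ} (cs : All Clash l) → All P (clashing cs) → s ∈ l → ∃[ c ] (P (left {s} c) × P (right {s} c))
    clashing-lookup (c ∷ cs) (p ∷ q ∷ ps) (here ≡.refl) = c , p , q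
    clashing-lookup (c ∷ cs) (p ∷ q ∷ ps) (there s∈)    = clashing-lookup cs ps s∈

    abstract
      residues : List Residue
      residues = cartesianProduct (allFin 10) (allFin 10)

      ∈-residues : ∀ s → s ∈ residues
      ∈-residues (x , y) = ∈-cartesianProduct⁺ (∈-allFin x) (∈-allFin y)

    -- A patch containing a clash for every residue has a residue of its own.
    ¬all-clash : ¬ All Clash residues
    ¬all-clash cs = from-patch (patch (base ∷ clashing cs) (base∈T ∷ clashing⊆T cs))
      where
      from-patch : ¬ (∃[ n ] ∃[ F ] (Orthonormal F × All (Placed n F) (base ∷ clashing cs)))
      from-patch (n , F , o , (w , b≈) ∷ placed) =
        let c , l , r = clashing-lookup cs placed (∈-residues (residue (origin (pos w)))) in proper-in-patch w c o b≈ l r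

    ¬proper⇒¬¬clash : ∀ {s} → ¬ Proper s → ¬ ¬ Clash s
    ¬proper⇒¬¬clash ¬proper ¬clash = ¬proper λ t∈T u∈T t≉u share same → ¬clash (clash t∈T u∈T t≉u share same)

    -- Double negation shift, valid here because a list is finite.
    ¬¬-All : ∀ {A : Set} {P : Pred A 0ℓ} {l} → All (λ x → ¬ ¬ P x) l → ¬ ¬ All P l
    ¬¬-All []       k = k []
    ¬¬-All (p ∷ ps) k = p λ x → ¬¬-All ps λ xs → k (x ∷ xs)

    -- Weak excluded middle for `¬ Proper s` decides `¬ ¬ Proper s`, so the finite list can be
    -- searched. If the search failed, every residue would have a clash up to double negation, and
    -- double negations are harmless on the way to a contradiction.
    some-proper : ∃[ s ] ¬ ¬ Proper s
    some-proper = search (Any.any? (λ s → wlem (¬ Proper s)) residues)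
      where
      clash-from : ∀ {s} → ¬ ¬ ¬ Proper s → ¬ ¬ Clash s
      clash-from ¬¬¬p = ¬proper⇒¬¬clash λ p → ¬¬¬p λ ¬p → ¬p p
      search : Dec (Any (λ s → ¬ ¬ Proper s) residues) → ∃[ s ] ¬ ¬ Proper s
      search (yes found) = Any.satisfied found
      search (no none)   = contradiction ¬all-clash (¬¬-All (All.map clash-from (All.¬Any⇒All¬ residues none)))

    three-colouring : ProperFaceColouring T 3
    three-colouring = record
      { colour      = colour s
      ; colour-cong = colour-cong s
      ; proper      = λ t∈T u∈T t≉u share same → proj₂ some-proper λ proper → proper t∈T u∈T t≉u share same
      }
      where
      s : Residue
      s = proj₁ some-proper

    -- Three colours are needed

    Position : Set
    Position = Address 2 × Fin 3

    -- The member k of the trio in the level-2 supertile that has base at address v.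
    candidate : Position → Triangle
    candidate (v , k) = tile (frameOf base) (inv (pos v) ⋄ pos (trio k))

    -- Which candidates are the right ones depends on the address of `base` in a patch, but the
    -- patch is chosen only after the tiles that it must contain. So a tile of T is taken for each
    -- of the 25 · 3 candidates beforehand.
    witness : Position → Triangle
    witness x = proj₁ (covers (centroid (candidate x)))

    witness∈T : ∀ x → T (witness x)
    witness∈T x = proj₁ (proj₂ (covers (centroid (candidate x))))

    centroid∈witness : ∀ x → centroid (candidate x) ∈△ witness x
    centroid∈witness x = proj₂ (proj₂ (covers (centroid (candidate x))))

    abstract
      positions : List Position
      positions = cartesianProduct (map (λ (i , j) → i ∷ j ∷ []) (cartesianProduct (allFin 5) (allFin 5))) (allFin 3)

      ∈-positions : ∀ x → x ∈ positions
      ∈-positions (i ∷ j ∷ [] , k) =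
        ∈-cartesianProduct⁺ (∈-map⁺ (λ (i , j) → i ∷ j ∷ []) (∈-cartesianProduct⁺ (∈-allFin i) (∈-allFin j))) (∈-allFin k)

    Trio : Set
    Trio = Σ[ t ∈ (Fin 3 → Triangle) ] ((∀ k → T (t k)) × (∀ k l → k ≢ l → ¬ t k ≈△ t l × ShareSegment (t k) (t l)))

    module _ {n F} (o : Orthonormal F) (v : Address 2) (w : Address n) (base≈ : base ≈△ tile F (pos (v ++ w))) where

      candidate≈ : ∀ k → candidate (v , k) ≈△ tile F (pos (trio k ++ w))
      candidate≈ k = ≈△-trans (tri-cong (corners r) (≈△-trans (frameOf-cong base≈) (frameOf-tile F (pos (v ++ w)))))
        (≈△-trans (tile-▹ F (pos (v ++ w)) r) (≈△-reflexive (≡.cong (tile F) (≡.trans (≡.cong (_⋄ r) (pos-++ v w))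
          (≡.trans (⋄-assoc (κ (κ (pos w))) (pos v) r)
            (≡.trans (≡.cong (κ (κ (pos w)) ⋄_) (⋄-cancel-inv (pos v) (pos (trio k)) (Unit-pos v))) (≡.sym (pos-++ (trio k) w))))))))
        where
        r : Placement
        r = inv (pos v) ⋄ pos (trio k)

      centroid-in : ∀ k → centroid (candidate (v , k)) ∈int tile F (pos (trio k ++ w))
      centroid-in k = ∈int-cong (candidate≈ k) (centroid∈int (candidate (v , k)))

      -- The witness is a tile of the patch and contains a point interior to the tile at
      -- `trio k ++ w`, so their addresses cannot differ.
      witness≈ : ∀ k → Placed n F (witness (v , k)) → witness (v , k) ≈△ tile F (pos (trio k ++ w))
      witness≈ k (u , t≈) = identify ((trio k ++ w) ≟ₐ u)
        where
        identify : Dec (trio k ++ w ≡ u) → witness (v , k) ≈△ tile F (pos (trio k ++ w))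
        identify (yes ≡.refl) = t≈
        identify (no ≢u) = contradiction (∈△-cong t≈ (centroid∈witness (v , k)))
          (interiors-disjoint 0<1 o (trio k ++ w) u ≢u (centroid-in k))

      in-frame : ∀ k → tile (F ▹ κ (κ (pos w))) (pos (trio k)) ≈△ tile F (pos (trio k ++ w))
      in-frame k = ≈△-trans (tile-▹ F (κ (κ (pos w))) (pos (trio k))) (≈△-reflexive (≡.cong (tile F) (≡.sym (pos-++ (trio k) w))))

      distinct-tiles : ∀ k l → k ≢ l → ¬ tile F (pos (trio k ++ w)) ≈△ tile F (pos (trio l ++ w))
      distinct-tiles k l k≢l e = interiors-disjoint 0<1 o (trio k ++ w) (trio l ++ w)
        (λ eq → k≢l (trio-injective k l (Vec.++-injectiveˡ (trio k) (trio l) eq))) (centroid-in k) (∈△-cong e (int⇒∈△ (centroid-in k)))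
        where
        int⇒∈△ : ∀ {p t} → p ∈int t → p ∈△ t
        int⇒∈△ (α , β , γ , p , q , r , h) = α , β , γ , inj₁ p , inj₁ q , inj₁ r , h

      trio-in-patch : (∀ k → Placed n F (witness (v , k))) → Trio
      trio-in-patch placed = (λ k → witness (v , k)) , (λ k → witness∈T (v , k)) , λ k l k≢l →
        (λ e → distinct-tiles k l k≢l (≈△-trans (≈△-sym (witness≈ k (placed k))) (≈△-trans e (witness≈ l (placed l))))) ,
        ShareSegment-cong (≈△-trans (in-frame k) (≈△-sym (witness≈ k (placed k)))) (≈△-trans (in-frame l) (≈△-sym (witness≈ l (placed l))))
          (trio-share (Orthogonal-▹ (κ (κ (pos w))) o (Unit-κ (κ (pos w)) (Unit-κ (pos w) (Unit-pos w)))) k l k≢l)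

    trio-of-tiling : Trio
    trio-of-tiling = from-patch (patch (base ∷ map witness positions)
      (base∈T ∷ All.map⁺ (All.universal witness∈T positions)))
      where
      from-patch : ∃[ n ] ∃[ F ] (Orthonormal F × All (Placed n F) (base ∷ map witness positions)) → Trio
      from-patch (n , F , o , (i ∷ j ∷ w , base≈) ∷ placed) =
        trio-in-patch o (i ∷ j ∷ []) w base≈ (λ k → All.lookup (All.map⁻ placed) (∈-positions (i ∷ j ∷ [] , k)))

    three-colours-needed : ∀ m → ProperFaceColouring T m → 3 ℕ.≤ m
    three-colours-needed m colouring = needed trio-of-tiling
      where
      open ProperFaceColouring colouring using (proper) renaming (colour to shade)
      needed : Trio → 3 ℕ.≤ m
      needed (t , t∈T , adjacent) = Fin.injective⇒≤ {f = λ k → shade (t k) (t∈T k)} injective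
        where
        injective : ∀ {k l} → shade (t k) (t∈T k) ≡ shade (t l) (t∈T l) → k ≡ l
        injective {k} {l} e = decide (k Fin.≟ l)
          where
          decide : Dec (k ≡ l) → k ≡ l
          decide (yes k≡l) = k≡l
          decide (no k≢l)  = contradiction e (proper (t∈T k) (t∈T l) (proj₁ (adjacent k l k≢l)) (proj₂ (adjacent k l k≢l)))

theorem5p5 : (ℝ : RealNumbers) →
    (√5 : RealNumbers.Carrier ℝ) → Pinwheel.IsSqrt5 ℝ √5 →
    (T : Pred (Pinwheel.Triangle ℝ) 0ℓ) →
    Pinwheel.Substitution.IsRationalPinwheelTiling ℝ √5 T →
    Pinwheel.MinimalNumberOfColours ℝ T 3
theorem5p5 ℝ √5 √5-spec T T-tiling =
  three-colouring , three-colours-needed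
  where open Plane.Tiling ℝ √5 √5-spec T-tiling
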